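{- Let $\alpha(x_0)$ be a first-order formula, with exactly one free variable $x_0$, in the first-order language with equality and binary predicates $R_\lambda$ $(\lambda\in\Lambda)$, extended by the atoms $y\in E$ for safe $L$-expressions $E$. Then $\alpha(x_0)$ is a (local) first-order correspondent of some generalized Sahlqvist formula if and only if $\alpha(x_0)$ is logically equivalent to a generalized Kracht formula.
   Context: **Modal language.** $\Lambda$ is an index set. Modal formulas are built from propositional variables, $\top,\bot$, $\neg,\wedge,\vee,\to$, and unary modalities $\Diamond_\lambda,\Box_\lambda$ ($\lambda\in\Lambda$). A frame is $F=(W,(R_\lambda:\lambda\in\Lambda))$ with binary relations $R_\lambda$ on $W$; $F,x,\theta\models\phi$ is standard Kripke truth under a valuation $\theta$. A formula is positive if it contains neither $\neg$ nor $\to$ (it may contain $\top,\bot$); a negative formula is the negation of a positive formula. **Local correspondence.** $\alpha(x_0)$ is a first-order correspondent of a modal formula $\phi$ if for every frame $F$ and every point $w$: $F\models\alpha[w]$ iff $F,w,\theta\models\phi$ for all valuations $\theta$. **Regular box-formulas.** The propositional variables are split into countably many groups, $p^k_1,p^k_2,\dots$ being the variables of rank $k$ ($k=0,1,2,\dots$). Regular box-formulas of rank $k$ are defined recursively: each variable $p^k_i$ is one; if $POS$ is a positive formula all of whose variables have rank $<k$ and $REG$ is a regular box-formula of rank $k$, then $POS\to REG$ is one; if $REG$ is one, so is $\Box_\lambda REG$. **Generalized Sahlqvist formulas.** A generalized Sahlqvist implication is a formula $GSA\to\bot$, where $GSA$ is built from regular box-formulas and negative formulas using only $\wedge,\vee,\Diamond_\lambda$.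 A generalized Sahlqvist formula is a formula built from generalized Sahlqvist implications by applying boxes and conjunctions, and by applying disjunctions only to formulas without common propositional variables. (The particular assignment of ranks to variables is immaterial, i.e. formulas are considered up to renaming of variables.) **$L$-expressions.** $L$-expressions are terms built from object variables $x_i$ (any first-order variables) and constants $\top,\bot$ using binary $\cap,\cup$ and unary $R_\lambda^{ -1},R_\lambda^{\Box},R_\lambda$. For an $L$-expression $E$ the atom $y\in E$ abbreviates the first-order formula $(y\in E)^\#$ defined by: $(y\in x_i)^\#:=(y=x_i)$; $(y\in\top)^\#:=(y=y)$; $(y\in\bot)^\#:=\neg(y=y)$; $(y\in E_1\cap E_2)^\#$ and $(y\in E_1\cup E_2)^\#$ are the conjunction and disjunction of $(y\in E_1)^\#,(y\in E_2)^\#$; $(y\in R_\lambda^{ -1}(E))^\#:=\exists z(yR_\lambda z\wedge(z\in E)^\#)$; $(y\in R_\lambda^{\Box}(E))^\#:=\forall z(yR_\lambda z\to(z\in E)^\#)$; $(y\in R_\lambda(E))^\#:=\exists z(zR_\lambda y\wedge(z\in E)^\#)$ ($z$ fresh). **Safe expressions.** A subexpression $\psi$ of an $L$-expression $\phi$ is safe for $\phi$ if: $\psi=x_i$; or $\psi=R_\lambda(\psi')$ with $\psi'$ safe for $\phi$; or $\psi=\psi'\cap\psi''$ with $\psi'$ or $\psi''$ safe for $\phi$. An $L$-expression $\phi$ is safe if $\phi$ is safe for $\phi$ and for every subexpression $R_\lambda(\psi)$ of $\phi$, $\psi$ is safe for $\phi$. **Generalized Kracht formulas.** Restricted quantifiers: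 $(\forall y\triangleright_\lambda x)\beta$ abbreviates $\forall y(xR_\lambda y\to\beta)$, and $(\exists y\triangleright_\lambda x)\beta$ abbreviates $\exists y(xR_\lambda y\wedge\beta)$. A formula is clean if no variable occurs both free and bound and no two distinct quantifier occurrences bind the same variable. A formula is restrictedly positive if it is built from atoms $y\in E$ ($E$ safe) using $\wedge,\vee$ and restricted quantifiers. In a clean formula, a variable is inherently universal if it is free, or is bound by a restricted universal quantifier which is not in the scope of an existential quantifier. A generalized Kracht formula is a clean, restrictedly positive formula with exactly one free variable such that in every subformula $y\in E(v_1,\dots,v_k)$ all the variables $v_1,\dots,v_k$ of $E$ are inherently universal. -}

module Defs where

open import Data.Bool using (Bool; true; false; not)
open import Data.Empty using (⊥)
open import Data.Fin using (Fin; zero; suc)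
open import Data.Fin.Subset using (Subset) renaming (_∈_ to _∈ₛ_; ⊤ to full)
open import Data.Nat using (ℕ; suc; _<_)
open import Data.Product using (_×_; _,_; ∃-syntax)
open import Data.Sum using (_⊎_)
open import Data.Unit using (⊤)
open import Data.Vec using () renaming (_∷_ to _∷ᵥ_)
open import Data.Vec.Functional using (Vector; _∷_)
open import Function using (id; _∘_; _⇔_)
open import Relation.Binary.PropositionalEquality using (_≡_)
open import Relation.Nullary using (¬_)

private variable
  Λ : Set
  m n : ℕ

infix  9 ¬ᵐ_ ¬ᶠ_
infixr 7 _∧ᵐ_ _∧ᶠ_ _∩_
infixr 6 _∨ᵐ_ _∨ᶠ_ _∪_
infixr 5 _⇒ᵐ_ _⇒ᶠ_
infix  4 _≐_ _∈⟨_,_⟩ _occursIn_ _∈var_ _⊑_ _∈♯[_]_ _∈♯_ _freeIn_ _,_⊨_ _,_,_⊩_ _Corresponds_ _≋_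

record Frame (Λ : Set) : Set₁ where
  field
    W : Set
    R : Λ → W → W → Set
open Frame public

-- mkVar k i is the variable pᵏᵢ of rank k.
record Var : Set where
  constructor mkVar
  field
    rank  : ℕ
    index : ℕ
open Var public

data Modal (Λ : Set) : Set where
  var            : Var → Modal Λ
  ⊤ᵐ ⊥ᵐ          : Modal Λ
  ¬ᵐ_            : Modal Λ → Modal Λ
  _∧ᵐ_ _∨ᵐ_ _⇒ᵐ_ : Modal Λ → Modal Λ → Modal Λ
  ◇ □            : Λ → Modal Λ → Modal Λ

Valuation : Frame Λ → Set₁
Valuation F = Var → W F → Set

_,_,_⊩_ : (F : Frame Λ) → W F → Valuation F → Modal Λ → Set
F , x , θ ⊩ var p    = θ p x
F , x , θ ⊩ ⊤ᵐ       = ⊤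
F , x , θ ⊩ ⊥ᵐ       = ⊥
F , x , θ ⊩ ¬ᵐ φ     = ¬ (F , x , θ ⊩ φ)
F , x , θ ⊩ φ ∧ᵐ ψ   = (F , x , θ ⊩ φ) × (F , x , θ ⊩ ψ)
F , x , θ ⊩ φ ∨ᵐ ψ   = (F , x , θ ⊩ φ) ⊎ (F , x , θ ⊩ ψ)
F , x , θ ⊩ φ ⇒ᵐ ψ   = (F , x , θ ⊩ φ) → (F , x , θ ⊩ ψ)
F , x , θ ⊩ ◇ l φ    = ∃[ y ] R F l x y × (F , y , θ ⊩ φ)
F , x , θ ⊩ □ l φ    = ∀ y → R F l x y → F , y , θ ⊩ φ

_∈var_ : Var → Modal Λ → Set
p ∈var var q    = p ≡ q
p ∈var ⊤ᵐ       = ⊥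
p ∈var ⊥ᵐ       = ⊥
p ∈var ¬ᵐ φ     = p ∈var φ
p ∈var φ ∧ᵐ ψ   = p ∈var φ ⊎ p ∈var ψ
p ∈var φ ∨ᵐ ψ   = p ∈var φ ⊎ p ∈var ψ
p ∈var φ ⇒ᵐ ψ   = p ∈var φ ⊎ p ∈var ψ
p ∈var ◇ _ φ    = p ∈var φ
p ∈var □ _ φ    = p ∈var φ

data Positive {Λ} : Modal Λ → Set where
  var  : ∀ p → Positive (var p)
  ⊤ᵐ   : Positive ⊤ᵐ
  ⊥ᵐ   : Positive ⊥ᵐ
  _∧ᵐ_ : ∀ {φ ψ} → Positive φ → Positive ψ → Positive (φ ∧ᵐ ψ)
  _∨ᵐ_ : ∀ {φ ψ} → Positive φ → Positive ψ → Positive (φ ∨ᵐ ψ)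
  ◇    : ∀ l {φ} → Positive φ → Positive (◇ l φ)
  □    : ∀ l {φ} → Positive φ → Positive (□ l φ)

data RegularBox {Λ} (k : ℕ) : Modal Λ → Set where
  var : ∀ i → RegularBox k (var (mkVar k i))
  imp : ∀ {pos reg} → Positive pos → (∀ p → p ∈var pos → rank p < k) →
        RegularBox k reg → RegularBox k (pos ⇒ᵐ reg)
  □   : ∀ l {reg} → RegularBox k reg → RegularBox k (□ l reg)

data GSA {Λ} : Modal Λ → Set where
  reg  : ∀ {k φ} → RegularBox k φ → GSA φ
  neg  : ∀ {pos} → Positive pos → GSA (¬ᵐ pos)
  _∧ᵐ_ : ∀ {φ ψ} → GSA φ → GSA ψ → GSA (φ ∧ᵐ ψ)
  _∨ᵐ_ : ∀ {φ ψ} → GSA φ → GSA ψ → GSA (φ ∨ᵐ ψ)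
  ◇    : ∀ l {φ} → GSA φ → GSA (◇ l φ)

data GenSahlqvist {Λ} : Modal Λ → Set where
  imp  : ∀ {gsa} → GSA gsa → GenSahlqvist (gsa ⇒ᵐ ⊥ᵐ)
  □    : ∀ l {φ} → GenSahlqvist φ → GenSahlqvist (□ l φ)
  _∧ᵐ_ : ∀ {φ ψ} → GenSahlqvist φ → GenSahlqvist ψ → GenSahlqvist (φ ∧ᵐ ψ)
  disj : ∀ {φ ψ} → (∀ p → ¬ (p ∈var φ × p ∈var ψ)) →
         GenSahlqvist φ → GenSahlqvist ψ → GenSahlqvist (φ ∨ᵐ ψ)

-- Object variables are well-scoped de Bruijn indices, so no two
-- quantifiers bind the same variable, no variable is both free and
-- bound, and every formula below is clean.
data Expr (Λ : Set) (n : ℕ) : Set where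
  var       : Fin n → Expr Λ n
  ⊤ₑ ⊥ₑ     : Expr Λ n
  _∩_ _∪_   : Expr Λ n → Expr Λ n → Expr Λ n
  R⁻¹ R□ Rₑ : Λ → Expr Λ n → Expr Λ n

_occursIn_ : Fin n → Expr Λ n → Set
i occursIn var j    = i ≡ j
i occursIn ⊤ₑ       = ⊥
i occursIn ⊥ₑ       = ⊥
i occursIn (A ∩ B)  = i occursIn A ⊎ i occursIn B
i occursIn (A ∪ B)  = i occursIn A ⊎ i occursIn B
i occursIn R⁻¹ _ A  = i occursIn A
i occursIn R□ _ A   = i occursIn A
i occursIn Rₑ _ A   = i occursIn A

data _⊑_ {Λ n} (A : Expr Λ n) : Expr Λ n → Set where
  here : A ⊑ A
  ∩ˡ   : ∀ {B C} → A ⊑ B → A ⊑ B ∩ C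
  ∩ʳ   : ∀ {B C} → A ⊑ C → A ⊑ B ∩ C
  ∪ˡ   : ∀ {B C} → A ⊑ B → A ⊑ B ∪ C
  ∪ʳ   : ∀ {B C} → A ⊑ C → A ⊑ B ∪ C
  R⁻¹  : ∀ {l B} → A ⊑ B → A ⊑ R⁻¹ l B
  R□   : ∀ {l B} → A ⊑ B → A ⊑ R□ l B
  Rₑ   : ∀ {l B} → A ⊑ B → A ⊑ Rₑ l B

-- "A is safe for E", for a subexpression A of E.  The clauses do not
-- mention E, and subexpressions of A are subexpressions of E, so E is
-- not an argument.
data SafeSub {Λ n} : Expr Λ n → Set where
  var : ∀ i → SafeSub (var i)
  Rₑ  : ∀ l {A} → SafeSub A → SafeSub (Rₑ l A)
  ∩ˡ  : ∀ {A B} → SafeSub A → SafeSub (A ∩ B)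
  ∩ʳ  : ∀ {A B} → SafeSub B → SafeSub (A ∩ B)

record Safe (E : Expr Λ n) : Set where
  field
    whole  : SafeSub E
    images : ∀ l A → Rₑ l A ⊑ E → SafeSub A
open Safe public

-- At n is the type of additional atoms with free variables in Fin n.
data Formula (Λ : Set) (At : ℕ → Set) (n : ℕ) : Set where
  atom           : At n → Formula Λ At n
  _≐_            : Fin n → Fin n → Formula Λ At n
  rel            : Λ → Fin n → Fin n → Formula Λ At n
  ¬ᶠ_            : Formula Λ At n → Formula Λ At n
  _∧ᶠ_ _∨ᶠ_ _⇒ᶠ_ : Formula Λ At n → Formula Λ At n → Formula Λ At n
  ∀ᶠ ∃ᶠ          : Formula Λ At (suc n) → Formula Λ At n

FO : Set → ℕ → Set
FO Λ = Formula Λ (λ _ → ⊥)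

record SafeAtom (Λ : Set) (n : ℕ) : Set where
  constructor _∈⟨_,_⟩
  field
    point : Fin n
    expr  : Expr Λ n
    safe  : Safe expr
open SafeAtom public

ExtFO : Set → ℕ → Set
ExtFO Λ = Formula Λ (SafeAtom Λ)

-- (y ∈ E)♯ with the variables of E renamed by ρ; going under a
-- quantifier weakens ρ, so that the new variable zero is fresh for E.
_∈♯[_]_ : Fin m → (Fin n → Fin m) → Expr Λ n → FO Λ m
y ∈♯[ ρ ] var i    = y ≐ ρ i
y ∈♯[ ρ ] ⊤ₑ       = y ≐ y
y ∈♯[ ρ ] ⊥ₑ       = ¬ᶠ (y ≐ y)
y ∈♯[ ρ ] (A ∩ B)  = (y ∈♯[ ρ ] A) ∧ᶠ (y ∈♯[ ρ ] B)
y ∈♯[ ρ ] (A ∪ B)  = (y ∈♯[ ρ ] A) ∨ᶠ (y ∈♯[ ρ ] B)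
y ∈♯[ ρ ] R⁻¹ l A  = ∃ᶠ (rel l (suc y) zero ∧ᶠ (zero ∈♯[ suc ∘ ρ ] A))
y ∈♯[ ρ ] R□ l A   = ∀ᶠ (rel l (suc y) zero ⇒ᶠ (zero ∈♯[ suc ∘ ρ ] A))
y ∈♯[ ρ ] Rₑ l A   = ∃ᶠ (rel l zero (suc y) ∧ᶠ (zero ∈♯[ suc ∘ ρ ] A))

_∈♯_ : Fin n → Expr Λ n → FO Λ n
y ∈♯ E = y ∈♯[ id ] E

expand : ExtFO Λ n → FO Λ n
expand (atom a)  = point a ∈♯ expr a
expand (x ≐ y)   = x ≐ y
expand (rel l x y) = rel l x y
expand (¬ᶠ α)    = ¬ᶠ expand α
expand (α ∧ᶠ β)  = expand α ∧ᶠ expand β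
expand (α ∨ᶠ β)  = expand α ∨ᶠ expand β
expand (α ⇒ᶠ β)  = expand α ⇒ᶠ expand β
expand (∀ᶠ α)    = ∀ᶠ (expand α)
expand (∃ᶠ α)    = ∃ᶠ (expand α)

_,_⊨_ : (F : Frame Λ) → Vector (W F) n → FO Λ n → Set
F , ρ ⊨ (x ≐ y)    = ρ x ≡ ρ y
F , ρ ⊨ rel l x y  = R F l (ρ x) (ρ y)
F , ρ ⊨ (¬ᶠ α)     = ¬ (F , ρ ⊨ α)
F , ρ ⊨ (α ∧ᶠ β)   = (F , ρ ⊨ α) × (F , ρ ⊨ β)
F , ρ ⊨ (α ∨ᶠ β)   = (F , ρ ⊨ α) ⊎ (F , ρ ⊨ β)
F , ρ ⊨ (α ⇒ᶠ β)   = (F , ρ ⊨ α) → (F , ρ ⊨ β)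
F , ρ ⊨ ∀ᶠ α       = ∀ w → F , (w ∷ ρ) ⊨ α
F , ρ ⊨ ∃ᶠ α       = ∃[ w ] (F , (w ∷ ρ) ⊨ α)

_freeIn_ : Fin n → ExtFO Λ n → Set
i freeIn atom a     = i ≡ point a ⊎ i occursIn expr a
i freeIn (x ≐ y)    = i ≡ x ⊎ i ≡ y
i freeIn rel _ x y  = i ≡ x ⊎ i ≡ y
i freeIn (¬ᶠ α)     = i freeIn α
i freeIn (α ∧ᶠ β)   = i freeIn α ⊎ i freeIn β
i freeIn (α ∨ᶠ β)   = i freeIn α ⊎ i freeIn β
i freeIn (α ⇒ᶠ β)   = i freeIn α ⊎ i freeIn β
i freeIn ∀ᶠ α       = suc i freeIn α
i freeIn ∃ᶠ α       = suc i freeIn α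

-- Scoping allows no free variable other than zero, that is x₀.
OneFree : ExtFO Λ 1 → Set
OneFree α = zero freeIn α

_≋_ : ExtFO Λ n → ExtFO Λ n → Set₁
_≋_ {Λ} α β = (F : Frame Λ) (ρ : Vector (W F) _) →
              (F , ρ ⊨ expand α) ⇔ (F , ρ ⊨ expand β)

_Corresponds_ : ExtFO Λ 1 → Modal Λ → Set₁
_Corresponds_ {Λ} α φ = (F : Frame Λ) (w : W F) →
                        (F , (λ _ → w) ⊨ expand α) ⇔ (∀ θ → F , w , θ ⊩ φ)

-- In ∀▷ l x β and ∃▷ l x β the bound variable is zero in β; it is
-- distinct from the restricting variable x by scoping.
∀▷ ∃▷ : Λ → Fin n → ExtFO Λ (suc n) → ExtFO Λ n
∀▷ l x β = ∀ᶠ (rel l (suc x) zero ⇒ᶠ β)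
∃▷ l x β = ∃ᶠ (rel l (suc x) zero ∧ᶠ β)

data RestrictedlyPositive {Λ n} : ExtFO Λ n → Set where
  atom : ∀ a → RestrictedlyPositive (atom a)
  _∧ᶠ_ : ∀ {α β} → RestrictedlyPositive α → RestrictedlyPositive β →
         RestrictedlyPositive (α ∧ᶠ β)
  _∨ᶠ_ : ∀ {α β} → RestrictedlyPositive α → RestrictedlyPositive β →
         RestrictedlyPositive (α ∨ᶠ β)
  all▷ : ∀ l x {β} → RestrictedlyPositive β → RestrictedlyPositive (∀▷ l x β)
  ex▷  : ∀ l x {β} → RestrictedlyPositive β → RestrictedlyPositive (∃▷ l x β)

-- AtomsUniversal e U r: in the subformula derived by r, every atom
-- y ∈ E has only inherently universal variables in E.  Here U is the
-- set of inherently universal variables in scope, and e records whether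
-- the subformula lies in the scope of an existential quantifier.  The
-- quantifiers hidden in the expansion of y ∈ E are not counted.
AtomsUniversal : Bool → Subset n → {α : ExtFO Λ n} → RestrictedlyPositive α → Set
AtomsUniversal e U (atom a)   = ∀ i → i occursIn expr a → i ∈ₛ U
AtomsUniversal e U (r ∧ᶠ s)   = AtomsUniversal e U r × AtomsUniversal e U s
AtomsUniversal e U (r ∨ᶠ s)   = AtomsUniversal e U r × AtomsUniversal e U s
AtomsUniversal e U (all▷ _ _ r) = AtomsUniversal e (not e ∷ᵥ U) r
AtomsUniversal e U (ex▷ _ _ r)  = AtomsUniversal true (false ∷ᵥ U) r

record GenKracht (α : ExtFO Λ 1) : Set where
  field
    oneFree              : OneFree α
    restrictedlyPositive : RestrictedlyPositive α
    atomsUniversal       : AtomsUniversal false full restrictedlyPositive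
open GenKracht public

{-# OPTIONS --safe #-}
module Submission where

-- From Sahlqvist to Kracht, a tuple of regular box-formulas at given
-- points has a least valuation, built rank by rank; its values are
-- expressions whose spine ends in one of the points, so they are safe,
-- and the positive formulas evaluated at it become the atoms.  From
-- Kracht to Sahlqvist, below the inherently universal quantifiers every
-- atom involves a single other variable, so the remaining quantifiers
-- distribute and are absorbed into the expressions; a safe expression is
-- then encoded by a fresh propositional variable of which it is the least
-- value, and the universal prefix becomes a tree of diamonds.

open import Defs
open import Axiom.ExcludedMiddle using (ExcludedMiddle)
open import Data.Bool using (true; false)
open import Data.Empty using (⊥; ⊥-elim)
open import Data.Fin using (Fin; zero; suc)
open import Data.Fin.Subset using (Subset) renaming (_∈_ to _∈ₛ_; ⊤ to full)
open import Data.List using (List; []; _∷_; [_]; map; _++_; cartesianProductWith)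
open import Data.List.Membership.Propositional using (_∈_)
open import Data.List.Membership.Propositional.Properties
  using (∈-map⁺; ∈-map⁻; ∈-++⁺ˡ; ∈-++⁺ʳ; ∈-++⁻;
         ∈-cartesianProductWith⁺; ∈-cartesianProductWith⁻)
open import Data.List.Relation.Unary.All as All using (All; []; _∷_)
open import Data.List.Relation.Unary.All.Properties using (map⁺; map⁻)
open import Data.List.Relation.Unary.Any using (here; there)
open import Data.Nat using (ℕ; zero; suc; _≤_; _<_; s≤s; _≟_)
open import Data.Nat.Properties using (≤-refl; ≤-trans; <⇒≱; <-irrefl; n≤1+n)
open import Data.Product using (_×_; _,_; ∃-syntax; proj₁; proj₂; map₁; map₂; uncurry; swap)
open import Data.Product.Function.NonDependent.Propositional using (_×-⇔_)
open import Data.Sum using (_⊎_; inj₁; inj₂; [_,_]′; assocˡ; assocʳ)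
open import Data.Sum.Function.Propositional using (_⊎-⇔_)
open import Data.Unit using (⊤; tt)
open import Data.Vec using (_∷_; here; there)
open import Data.Vec.Functional using (Vector; updateAt) renaming (_∷_ to _∷ᶠ_)
open import Function using (id; _∘_; _⇔_; mk⇔; Equivalence)
open import Function.Construct.Composition using (_⇔-∘_)
open import Function.Construct.Identity using (⇔-id)
open import Function.Construct.Symmetry using (⇔-sym)
open import Function.Related.TypeIsomorphisms using (→-cong-⇔; ¬-cong-⇔)
open import Level using (Level; 0ℓ) renaming (suc to lsuc; _⊔_ to _⊔ˡ_)
open import Relation.Binary.PropositionalEquality
  using (_≡_; refl; sym; trans; cong₂; subst)
open import Relation.Nullary using (¬_; Dec; yes; no)
open import Relation.Nullary.Decidable using (map′; _×-dec_; toSum; decidable-stable)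

open Equivalence using (to; from)

-- Safety is what allows a modal formula to force a set. A regular box-formula speaks from one root,
-- so "φ holds on all of A" is expressible when images and intersections lead from A down to a
-- variable; other operations enter only inside antecedents, where any positive formula is allowed.
-- The obstacle towards Sahlqvist formulas is disjunction: quantification over valuations
-- distributes over it only when the disjuncts share no propositional variable, and disjunctions
-- occur below universal quantifiers, with several object variables in scope. Hence a property is
-- kept as a list of clauses with one modal label per object variable, and disjoint rank intervals
-- keep the pieces apart. Excluded middle is assumed for `Set` only, so cases are distinguished on
-- first-order truth and never on validity under all valuations, which lies one universe higher.

private variable
  Λ : Set
  m n k N N′ N″ : ℕ
  a b c ℓ ℓ′ : Level

∀-⇔ : {A : Set a} {B : A → Set b} {C : A → Set c} →
      (∀ x → B x ⇔ C x) → (∀ x → B x) ⇔ (∀ x → C x)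
∀-⇔ e = mk⇔ (λ f x → to (e x) (f x)) (λ f x → from (e x) (f x))

∃-⇔ : {A : Set a} {B : A → Set b} {C : A → Set c} →
      (∀ x → B x ⇔ C x) → (∃[ x ] B x) ⇔ (∃[ x ] C x)
∃-⇔ e = mk⇔ (map₂ (λ {x} → to (e x))) (map₂ (λ {x} → from (e x)))

-- Semantics of expressions, invariance and monotonicity of truth

⟦_⟧ : Expr Λ n → (F : Frame Λ) → Vector (W F) n → W F → Set
⟦ var i ⟧  F ρ y = y ≡ ρ i
⟦ ⊤ₑ ⟧     F ρ y = ⊤
⟦ ⊥ₑ ⟧     F ρ y = ⊥
⟦ A ∩ B ⟧  F ρ y = ⟦ A ⟧ F ρ y × ⟦ B ⟧ F ρ y
⟦ A ∪ B ⟧  F ρ y = ⟦ A ⟧ F ρ y ⊎ ⟦ B ⟧ F ρ y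
⟦ R⁻¹ l A ⟧ F ρ y = ∃[ z ] R F l y z × ⟦ A ⟧ F ρ z
⟦ R□ l A ⟧ F ρ y = ∀ z → R F l y z → ⟦ A ⟧ F ρ z
⟦ Rₑ l A ⟧ F ρ y = ∃[ z ] R F l z y × ⟦ A ⟧ F ρ z

∈♯-correct : (E : Expr Λ n) (σ : Fin n → Fin m) (y : Fin m) (F : Frame Λ)
             (ρ : Vector (W F) m) →
             (F , ρ ⊨ (y ∈♯[ σ ] E)) ⇔ ⟦ E ⟧ F (ρ ∘ σ) (ρ y)
∈♯-correct (var i)   σ y F ρ = ⇔-id _
∈♯-correct ⊤ₑ        σ y F ρ = mk⇔ _ (λ _ → refl)
∈♯-correct ⊥ₑ        σ y F ρ = mk⇔ (λ f → f refl) ⊥-elim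
∈♯-correct (A ∩ B)   σ y F ρ = ∈♯-correct A σ y F ρ ×-⇔ ∈♯-correct B σ y F ρ
∈♯-correct (A ∪ B)   σ y F ρ = ∈♯-correct A σ y F ρ ⊎-⇔ ∈♯-correct B σ y F ρ
∈♯-correct (R⁻¹ l A) σ y F ρ = ∃-⇔ λ z → ⇔-id _ ×-⇔ ∈♯-correct A (suc ∘ σ) zero F (z ∷ᶠ ρ)
∈♯-correct (R□ l A)  σ y F ρ = ∀-⇔ λ z → →-cong-⇔ (⇔-id _) (∈♯-correct A (suc ∘ σ) zero F (z ∷ᶠ ρ))
∈♯-correct (Rₑ l A)  σ y F ρ = ∃-⇔ λ z → ⇔-id _ ×-⇔ ∈♯-correct A (suc ∘ σ) zero F (z ∷ᶠ ρ)

⊨-cong : (α : FO Λ n) (F : Frame Λ) {ρ σ : Vector (W F) n} → (∀ i → ρ i ≡ σ i) →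
         (F , ρ ⊨ α) ⇔ (F , σ ⊨ α)
⊨-cong (x ≐ y) F e rewrite e x | e y = ⇔-id _
⊨-cong (rel l x y) F e rewrite e x | e y = ⇔-id _
⊨-cong (¬ᶠ α) F e = ¬-cong-⇔ (⊨-cong α F e)
⊨-cong (α ∧ᶠ β) F e = ⊨-cong α F e ×-⇔ ⊨-cong β F e
⊨-cong (α ∨ᶠ β) F e = ⊨-cong α F e ⊎-⇔ ⊨-cong β F e
⊨-cong (α ⇒ᶠ β) F e = →-cong-⇔ (⊨-cong α F e) (⊨-cong β F e)
⊨-cong (∀ᶠ α) F e = ∀-⇔ λ w → ⊨-cong α F λ { zero → refl ; (suc i) → e i }
⊨-cong (∃ᶠ α) F e = ∃-⇔ λ w → ⊨-cong α F λ { zero → refl ; (suc i) → e i }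

⊩-cong : (φ : Modal Λ) (F : Frame Λ) {θ η : Valuation F} →
         (∀ p → p ∈var φ → ∀ y → θ p y ⇔ η p y) → ∀ x →
         (F , x , θ ⊩ φ) ⇔ (F , x , η ⊩ φ)
⊩-cong (var p) F e x = e p refl x
⊩-cong ⊤ᵐ F e x = ⇔-id _
⊩-cong ⊥ᵐ F e x = ⇔-id _
⊩-cong (¬ᵐ φ) F e x = ¬-cong-⇔ (⊩-cong φ F e x)
⊩-cong (φ ∧ᵐ ψ) F e x =
  ⊩-cong φ F (λ p → e p ∘ inj₁) x ×-⇔ ⊩-cong ψ F (λ p → e p ∘ inj₂) x
⊩-cong (φ ∨ᵐ ψ) F e x =
  ⊩-cong φ F (λ p → e p ∘ inj₁) x ⊎-⇔ ⊩-cong ψ F (λ p → e p ∘ inj₂) x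
⊩-cong (φ ⇒ᵐ ψ) F e x =
  →-cong-⇔ (⊩-cong φ F (λ p → e p ∘ inj₁) x) (⊩-cong ψ F (λ p → e p ∘ inj₂) x)
⊩-cong (◇ l φ) F e x = ∃-⇔ λ y → ⇔-id _ ×-⇔ ⊩-cong φ F e y
⊩-cong (□ l φ) F e x = ∀-⇔ λ y → →-cong-⇔ (⇔-id _) (⊩-cong φ F e y)

⊩-mono : {φ : Modal Λ} → Positive φ → (F : Frame Λ) {θ η : Valuation F} →
         (∀ p → p ∈var φ → ∀ y → θ p y → η p y) → ∀ x →
         (F , x , θ ⊩ φ) → (F , x , η ⊩ φ)
⊩-mono (var p) F e x h = e p refl x h
⊩-mono ⊤ᵐ F e x h = h
⊩-mono (s ∧ᵐ t) F e x (h , h′) =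
  ⊩-mono s F (λ p → e p ∘ inj₁) x h , ⊩-mono t F (λ p → e p ∘ inj₂) x h′
⊩-mono (s ∨ᵐ t) F e x (inj₁ h) = inj₁ (⊩-mono s F (λ p → e p ∘ inj₁) x h)
⊩-mono (s ∨ᵐ t) F e x (inj₂ h) = inj₂ (⊩-mono t F (λ p → e p ∘ inj₂) x h)
⊩-mono (◇ l s) F e x (y , r , h) = y , r , ⊩-mono s F e y h
⊩-mono (□ l s) F e x h y r = ⊩-mono s F e y (h y r)

-- Gluing two valuations is how formulas without common variables are separated. As a disjunction it
-- makes sense without a decision procedure for `P`.
ifᵛ : {F : Frame Λ} → (Var → Set) → Valuation F → Valuation F → Valuation F
ifᵛ P θ η p y = (P p × θ p y) ⊎ (¬ P p × η p y)

ifᵛ-yes : (P : Var → Set) (φ : Modal Λ) (F : Frame Λ) {θ η : Valuation F} →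
          (∀ p → p ∈var φ → P p) → ∀ x →
          (F , x , ifᵛ {F = F} P θ η ⊩ φ) ⇔ (F , x , θ ⊩ φ)
ifᵛ-yes P φ F all = ⊩-cong φ F λ p v y →
  mk⇔ (λ { (inj₁ (_ , h)) → h ; (inj₂ (¬v , _)) → ⊥-elim (¬v (all p v)) })
      (λ h → inj₁ (all p v , h))

ifᵛ-no : (P : Var → Set) (φ : Modal Λ) (F : Frame Λ) {θ η : Valuation F} →
         (∀ p → p ∈var φ → ¬ P p) → ∀ x →
         (F , x , ifᵛ {F = F} P θ η ⊩ φ) ⇔ (F , x , η ⊩ φ)
ifᵛ-no P φ F none = ⊩-cong φ F λ p v y →
  mk⇔ (λ { (inj₁ (v′ , _)) → ⊥-elim (none p v v′) ; (inj₂ (_ , h)) → h })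
      (λ h → inj₂ (none p v , h))

-- This half of `Safe` passes to all subexpressions and is kept by unions, preimages and boxes; the
-- other half is restored at an atom.
ImageSafe : Expr Λ n → Set
ImageSafe {Λ} {n} E = ∀ l (A : Expr Λ n) → Rₑ l A ⊑ E → SafeSub A

_∩ⁱ_ : {A B : Expr Λ n} → ImageSafe A → ImageSafe B → ImageSafe (A ∩ B)
(s ∩ⁱ t) l C (∩ˡ h) = s l C h
(s ∩ⁱ t) l C (∩ʳ h) = t l C h

_∪ⁱ_ : {A B : Expr Λ n} → ImageSafe A → ImageSafe B → ImageSafe (A ∪ B)
(s ∪ⁱ t) l C (∪ˡ h) = s l C h
(s ∪ⁱ t) l C (∪ʳ h) = t l C h

R⁻¹ⁱ : ∀ {l} {A : Expr Λ n} → ImageSafe A → ImageSafe (R⁻¹ l A)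
R⁻¹ⁱ s l C (R⁻¹ h) = s l C h

R□ⁱ : ∀ {l} {A : Expr Λ n} → ImageSafe A → ImageSafe (R□ l A)
R□ⁱ s l C (R□ h) = s l C h

Rₑⁱ : ∀ {l} {A : Expr Λ n} → SafeSub A → ImageSafe A → ImageSafe (Rₑ l A)
Rₑⁱ w s l C here = w
Rₑⁱ w s l C (Rₑ h) = s l C h

-- From Sahlqvist formulas to Kracht formulas

Property : Set → ℕ → (ℓ : Level) → Set (lsuc 0ℓ ⊔ˡ lsuc ℓ)
Property Λ n ℓ = (F : Frame Λ) → Vector (W F) n → Set ℓ

-- `P` may live above `Set`, as it quantifies over valuations; defining it eliminates that
-- quantifier. The set `full` fits because only universal quantifiers are ever produced here.
record KrachtDefinable {Λ n} (P : Property Λ n ℓ) : Set (lsuc 0ℓ ⊔ˡ ℓ) where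
  field
    formula    : ExtFO Λ n
    restricted : RestrictedlyPositive formula
    universal  : AtomsUniversal false full restricted
    correct    : ∀ F ρ → (F , ρ ⊨ expand formula) ⇔ P F ρ
open KrachtDefinable

kracht-resp : {P : Property Λ n ℓ} {Q : Property Λ n ℓ′} →
              (∀ F ρ → P F ρ ⇔ Q F ρ) → KrachtDefinable P → KrachtDefinable Q
kracht-resp e d = record
  { formula    = formula d
  ; restricted = restricted d
  ; universal  = universal d
  ; correct    = λ F ρ → e F ρ ⇔-∘ correct d F ρ
  }

kracht-∧ : {P : Property Λ n ℓ} {Q : Property Λ n ℓ′} →
           KrachtDefinable P → KrachtDefinable Q → KrachtDefinable (λ F ρ → P F ρ × Q F ρ)
kracht-∧ d e = record
  { formula    = formula d ∧ᶠ formula e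
  ; restricted = restricted d ∧ᶠ restricted e
  ; universal  = universal d , universal e
  ; correct    = λ F ρ → correct d F ρ ×-⇔ correct e F ρ
  }

kracht-∨ : {P : Property Λ n ℓ} {Q : Property Λ n ℓ′} →
           KrachtDefinable P → KrachtDefinable Q → KrachtDefinable (λ F ρ → P F ρ ⊎ Q F ρ)
kracht-∨ d e = record
  { formula    = formula d ∨ᶠ formula e
  ; restricted = restricted d ∨ᶠ restricted e
  ; universal  = universal d , universal e
  ; correct    = λ F ρ → correct d F ρ ⊎-⇔ correct e F ρ
  }

kracht-∀ : ∀ l x {P : Property Λ (suc n) ℓ} → KrachtDefinable P →
           KrachtDefinable (λ F ρ → ∀ w → R F l (ρ x) w → P F (w ∷ᶠ ρ))
kracht-∀ l x d = record
  { formula    = ∀▷ l x (formula d)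
  ; restricted = all▷ l x (restricted d)
  ; universal  = universal d
  ; correct    = λ F ρ → ∀-⇔ λ w → →-cong-⇔ (⇔-id _) (correct d F (w ∷ᶠ ρ))
  }

∈full : (i : Fin n) → i ∈ₛ full
∈full zero = here
∈full (suc i) = there (∈full i)

-- Intersecting with {x} makes the whole expression safe.
kracht-atom : ∀ x (E : Expr Λ n) → ImageSafe E → KrachtDefinable (λ F ρ → ⟦ E ⟧ F ρ (ρ x))
kracht-atom x E s = record
  { formula    = atom (x ∈⟨ var x ∩ E , record { whole = ∩ˡ (var x) ; images = (λ _ _ ()) ∩ⁱ s } ⟩)
  ; restricted = atom _
  ; universal  = λ i _ → ∈full i
  ; correct    = λ F ρ → mk⇔ proj₂ (refl ,_) ⇔-∘ ∈♯-correct (var x ∩ E) id x F ρ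
  }

fromPositive : {φ : Modal Λ} → (Var → Expr Λ n) → Positive φ → Expr Λ n
fromPositive M (var p)  = M p
fromPositive M ⊤ᵐ       = ⊤ₑ
fromPositive M ⊥ᵐ       = ⊥ₑ
fromPositive M (s ∧ᵐ t) = fromPositive M s ∩ fromPositive M t
fromPositive M (s ∨ᵐ t) = fromPositive M s ∪ fromPositive M t
fromPositive M (◇ l s)  = R⁻¹ l (fromPositive M s)
fromPositive M (□ l s)  = R□ l (fromPositive M s)

fromPositive-safe : {φ : Modal Λ} (M : Var → Expr Λ n) → (∀ p → ImageSafe (M p)) →
                    (s : Positive φ) → ImageSafe (fromPositive M s)
fromPositive-safe M h (var p)  = h p
fromPositive-safe M h ⊤ᵐ       = λ _ _ ()
fromPositive-safe M h ⊥ᵐ       = λ _ _ ()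
fromPositive-safe M h (s ∧ᵐ t) = fromPositive-safe M h s ∩ⁱ fromPositive-safe M h t
fromPositive-safe M h (s ∨ᵐ t) = fromPositive-safe M h s ∪ⁱ fromPositive-safe M h t
fromPositive-safe M h (◇ l s)  = R⁻¹ⁱ (fromPositive-safe M h s)
fromPositive-safe M h (□ l s)  = R□ⁱ (fromPositive-safe M h s)

fromPositive-correct : {φ : Modal Λ} (M : Var → Expr Λ n) (s : Positive φ) (F : Frame Λ)
                       (ρ : Vector (W F) n) (y : W F) →
                       (F , y , (λ p → ⟦ M p ⟧ F ρ) ⊩ φ) ⇔ ⟦ fromPositive M s ⟧ F ρ y
fromPositive-correct M (var p)  F ρ y = ⇔-id _
fromPositive-correct M ⊤ᵐ       F ρ y = ⇔-id _
fromPositive-correct M ⊥ᵐ       F ρ y = ⇔-id _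
fromPositive-correct M (s ∧ᵐ t) F ρ y =
  fromPositive-correct M s F ρ y ×-⇔ fromPositive-correct M t F ρ y
fromPositive-correct M (s ∨ᵐ t) F ρ y =
  fromPositive-correct M s F ρ y ⊎-⇔ fromPositive-correct M t F ρ y
fromPositive-correct M (◇ l s)  F ρ y =
  ∃-⇔ λ z → ⇔-id _ ×-⇔ fromPositive-correct M s F ρ z
fromPositive-correct M (□ l s)  F ρ y =
  ∀-⇔ λ z → →-cong-⇔ (⇔-id _) (fromPositive-correct M s F ρ z)

-- Least valuations of regular box-formulas

head : {φ : Modal Λ} → RegularBox k φ → Var
head {k = k} (var i) = mkVar k i
head (imp _ _ r)     = head r
head (□ _ r)         = head r

rank-head : {φ : Modal Λ} (r : RegularBox k φ) → rank (head r) ≡ k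
rank-head (var i)     = refl
rank-head (imp _ _ r) = rank-head r
rank-head (□ _ r)     = rank-head r

-- The least value of the head variable for which the regular
-- box-formula holds on all of E, when the other variables denote M.
least : {φ : Modal Λ} → RegularBox k φ → (Var → Expr Λ n) → Expr Λ n → Expr Λ n
least (var i)     M E = E
least (imp s _ r) M E = least r M (E ∩ fromPositive M s)
least (□ l r)     M E = least r M (Rₑ l E)

least-safe : {φ : Modal Λ} (r : RegularBox k φ) (M : Var → Expr Λ n) →
             (∀ p → ImageSafe (M p)) → {E : Expr Λ n} →
             SafeSub E → ImageSafe E → ImageSafe (least r M E)
least-safe (var i)     M h w s = s
least-safe (imp t _ r) M h w s = least-safe r M h (∩ˡ w) (s ∩ⁱ fromPositive-safe M h t)
least-safe (□ l r)     M h w s = least-safe r M h (Rₑ l w) (Rₑⁱ w s)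

least-mono : {φ : Modal Λ} (r : RegularBox k φ) {M M′ : Var → Expr Λ n} {E E′ : Expr Λ n}
             (F : Frame Λ) (ρ : Vector (W F) n) →
             (∀ p y → ⟦ M p ⟧ F ρ y → ⟦ M′ p ⟧ F ρ y) →
             (∀ y → ⟦ E ⟧ F ρ y → ⟦ E′ ⟧ F ρ y) →
             ∀ y → ⟦ least r M E ⟧ F ρ y → ⟦ least r M′ E′ ⟧ F ρ y
least-mono (var i)     F ρ h e = e
least-mono (imp s _ r) {M} {M′} F ρ h e = least-mono r F ρ h λ y (u , v) →
  e y u , to (fromPositive-correct M′ s F ρ y)
             (⊩-mono s F (λ p _ → h p) y (from (fromPositive-correct M s F ρ y) v))
least-mono (□ l r)     F ρ h e = least-mono r F ρ h λ { y (z , s , u) → z , s , e z u }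

least-minimal : {φ : Modal Λ} (r : RegularBox k φ) {M : Var → Expr Λ n} {E : Expr Λ n}
                (F : Frame Λ) (ρ : Vector (W F) n) {θ : Valuation F} →
                (∀ p y → ⟦ M p ⟧ F ρ y → θ p y) →
                (∀ y → ⟦ E ⟧ F ρ y → F , y , θ ⊩ φ) →
                ∀ y → ⟦ least r M E ⟧ F ρ y → θ (head r) y
least-minimal (var i)     F ρ h e = e
least-minimal (imp s _ r) {M} F ρ h e = least-minimal r F ρ h λ y (u , v) →
  e y u (⊩-mono s F (λ p _ → h p) y (from (fromPositive-correct M s F ρ y) v))
least-minimal (□ l r)     F ρ h e = least-minimal r F ρ h λ { y (z , s , u) → e z u y s }

-- Antecedents are contravariant, so `θ` must lie below `M`, opposite to `least-minimal`. Ranks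
-- below `k` suffice, since antecedents contain no other variables.
least-satisfies : {φ : Modal Λ} (r : RegularBox k φ) {M : Var → Expr Λ n} {E : Expr Λ n}
                  (F : Frame Λ) (ρ : Vector (W F) n) {θ : Valuation F} →
                  (∀ p → rank p < k → ∀ y → θ p y → ⟦ M p ⟧ F ρ y) →
                  (∀ y → ⟦ least r M E ⟧ F ρ y → θ (head r) y) →
                  ∀ y → ⟦ E ⟧ F ρ y → F , y , θ ⊩ φ
least-satisfies (var i)     F ρ h e y u = e y u
least-satisfies (imp s lt r) {M} F ρ h e y u v = least-satisfies r F ρ h e y
  (u , to (fromPositive-correct M s F ρ y) (⊩-mono s F (λ p o → h p (lt p o)) y v))
least-satisfies (□ l r)     F ρ h e y u z s = least-satisfies r F ρ h e z (y , s , u)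

_≟ᵛ_ : (p q : Var) → Dec (p ≡ q)
p ≟ᵛ q = map′ (uncurry (cong₂ mkVar)) (λ { refl → refl , refl })
              ((rank p ≟ rank q) ×-dec (index p ≟ index q))

Regulars : Set → ℕ → Set
Regulars Λ n = List (Fin n × ∃[ k ] ∃[ φ ] RegularBox {Λ} k φ)

Positives : Set → ℕ → Set
Positives Λ n = List (Fin n × ∃[ φ ] Positive {Λ} φ)

Regular : (F : Frame Λ) → Vector (W F) n → Valuation F → Regulars Λ n → Set
Regular F ρ θ = All λ (x , _ , φ , _) → F , ρ x , θ ⊩ φ

Refutes : (F : Frame Λ) → Vector (W F) n → Valuation F → Positives Λ n → Set
Refutes F ρ θ = All λ (x , φ , _) → ¬ (F , ρ x , θ ⊩ φ)

-- Several regular box-formulas may share a head; a variable heading none of them gets the empty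
-- set.
leastUnion : (Var → Expr Λ n) → Regulars Λ n → Var → Expr Λ n
leastUnion M [] p = ⊥ₑ
leastUnion M ((x , _ , _ , r) ∷ rs) p with head r ≟ᵛ p
... | yes _ = least r M (var x) ∪ leastUnion M rs p
... | no _  = leastUnion M rs p

leastUnion-safe : (M : Var → Expr Λ n) → (∀ p → ImageSafe (M p)) →
                  ∀ rs p → ImageSafe (leastUnion M rs p)
leastUnion-safe M h [] p = λ _ _ ()
leastUnion-safe M h ((x , _ , _ , r) ∷ rs) p with head r ≟ᵛ p
... | yes _ = least-safe r M h (var x) (λ _ _ ()) ∪ⁱ leastUnion-safe M h rs p
... | no _  = leastUnion-safe M h rs p

leastUnion-mono : {M M′ : Var → Expr Λ n} (F : Frame Λ) (ρ : Vector (W F) n) →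
                  (∀ p y → ⟦ M p ⟧ F ρ y → ⟦ M′ p ⟧ F ρ y) → ∀ rs p y →
                  ⟦ leastUnion M rs p ⟧ F ρ y → ⟦ leastUnion M′ rs p ⟧ F ρ y
leastUnion-mono F ρ h ((x , _ , _ , r) ∷ rs) p y u with head r ≟ᵛ p | u
... | yes _ | inj₁ v = inj₁ (least-mono r F ρ h (λ _ → id) y v)
... | yes _ | inj₂ v = inj₂ (leastUnion-mono F ρ h rs p y v)
... | no _  | v      = leastUnion-mono F ρ h rs p y v

leastUnion-minimal : {M : Var → Expr Λ n} (F : Frame Λ) (ρ : Vector (W F) n) {θ : Valuation F} →
                     (∀ p y → ⟦ M p ⟧ F ρ y → θ p y) → ∀ {rs} → Regular F ρ θ rs →
                     ∀ p y → ⟦ leastUnion M rs p ⟧ F ρ y → θ p y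
leastUnion-minimal F ρ h {(x , _ , _ , r) ∷ rs} (s ∷ ss) p y u with head r ≟ᵛ p | u
... | yes refl | inj₁ v = least-minimal r F ρ h (λ { _ refl → s }) y v
... | yes _    | inj₂ v = leastUnion-minimal F ρ h ss p y v
... | no _     | v      = leastUnion-minimal F ρ h ss p y v

leastUnion-⊇ : {M : Var → Expr Λ n} (F : Frame Λ) (ρ : Vector (W F) n) → ∀ {x k φ r rs} →
               (x , k , φ , r) ∈ rs →
               ∀ y → ⟦ least r M (var x) ⟧ F ρ y → ⟦ leastUnion M rs (head r) ⟧ F ρ y
leastUnion-⊇ F ρ {r = r} (here refl) y u with head r ≟ᵛ head r
... | yes _ = inj₁ u
... | no ¬e = ⊥-elim (¬e refl)
leastUnion-⊇ F ρ {r = r} {(_ , _ , _ , r′) ∷ _} (there i) y u with head r′ ≟ᵛ head r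
... | yes _ = inj₂ (leastUnion-⊇ F ρ i y u)
... | no _  = leastUnion-⊇ F ρ i y u

-- A variable of rank r has reached its final value at stage r + 1.
stage : Regulars Λ n → ℕ → Var → Expr Λ n
stage rs zero    p = ⊥ₑ
stage rs (suc k) p = leastUnion (stage rs k) rs p

stage-safe : (rs : Regulars Λ n) → ∀ k p → ImageSafe (stage rs k p)
stage-safe rs zero    p = λ _ _ ()
stage-safe rs (suc k) p = leastUnion-safe (stage rs k) (stage-safe rs k) rs p

stage-mono : (rs : Regulars Λ n) (F : Frame Λ) (ρ : Vector (W F) n) → ∀ {j k} → j ≤ k →
             ∀ p y → ⟦ stage rs j p ⟧ F ρ y → ⟦ stage rs k p ⟧ F ρ y
stage-mono rs F ρ (s≤s j≤k) p y = leastUnion-mono F ρ (stage-mono rs F ρ j≤k) rs p y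

stage-minimal : (rs : Regulars Λ n) (F : Frame Λ) (ρ : Vector (W F) n) {θ : Valuation F} →
                Regular F ρ θ rs → ∀ k p y → ⟦ stage rs k p ⟧ F ρ y → θ p y
stage-minimal rs F ρ h (suc k) = leastUnion-minimal F ρ (stage-minimal rs F ρ h k) h

minimal : Regulars Λ n → Var → Expr Λ n
minimal rs p = stage rs (suc (rank p)) p

minimal-regular : (rs : Regulars Λ n) (F : Frame Λ) (ρ : Vector (W F) n) →
                  Regular F ρ (λ p → ⟦ minimal rs p ⟧ F ρ) rs
minimal-regular rs F ρ = All.tabulate λ { {x , k , φ , r} i →
  -- A variable of rank below `k` takes its value at a stage no later than `k`, the stage from which
  -- the value of the head is computed.
  least-satisfies r F ρ (λ p lt → stage-mono rs F ρ lt p)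
    (λ y u → leastUnion-⊇ F ρ {r = r} i y
      (subst (λ j → ⟦ least r (stage rs j) (var x) ⟧ F ρ y) (sym (rank-head r)) u))
    (ρ x) refl }

-- Eliminating the quantifier over valuations

-- Classically this is a finite disjunction of atoms. The given variable provides a point for the
-- false atom that ends it.
kracht-¬refutes : ExcludedMiddle 0ℓ → Fin n → (M : Var → Expr Λ n) → (∀ p → ImageSafe (M p)) →
                  (ps : Positives Λ n) →
                  KrachtDefinable (λ F ρ → ¬ Refutes F ρ (λ p → ⟦ M p ⟧ F ρ) ps)
kracht-¬refutes em x M h [] = kracht-resp
  (λ F ρ → mk⇔ ⊥-elim (λ f → f [])) (kracht-atom x ⊥ₑ λ _ _ ())
kracht-¬refutes em x M h ((y , φ , s) ∷ ps) = kracht-resp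
  (λ F ρ → let e = fromPositive-correct M s F ρ (ρ y) in mk⇔
    (λ { (inj₁ u) (f ∷ _) → f (from e u) ; (inj₂ g) (_ ∷ fs) → g fs })
    (λ g → [ inj₁ , (λ ¬u → inj₂ λ fs → g (¬u ∘ to e ∷ fs)) ]′ (toSum em)))
  (kracht-∨ (kracht-atom y (fromPositive M s) (fromPositive-safe M h s))
            (kracht-¬refutes em x M h ps))

Unsatisfiable : Regulars Λ n → Positives Λ n → Property Λ n (lsuc 0ℓ)
Unsatisfiable rs ps F ρ = ∀ θ → Regular F ρ θ rs → Refutes F ρ θ ps → ⊥

-- Any valuation satisfying `rs` lies above the minimal one, and refuting positive formulas is
-- preserved when a valuation shrinks. So testing the minimal valuation is enough.
kracht-unsatisfiable : ExcludedMiddle 0ℓ → Fin n → (rs : Regulars Λ n) (ps : Positives Λ n) →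
                       KrachtDefinable (Unsatisfiable rs ps)
kracht-unsatisfiable em x rs ps = kracht-resp
  (λ F ρ → mk⇔
    (λ f θ reg ref → f (All.map (λ {(_ , _ , s)} g h → g (⊩-mono s F
      (λ p _ → stage-minimal rs F ρ reg (suc (rank p)) p) _ h)) ref))
    (λ f → f _ (minimal-regular rs F ρ)))
  (kracht-¬refutes em x (minimal rs) (λ p → stage-safe rs (suc (rank p)) p) ps)

-- Rest stands for the formulas still to be unfolded; the variables
-- bound meanwhile do not occur in it.
kracht-gsa : {φ : Modal Λ} → GSA φ → (x : Fin n)
             (Rest : (F : Frame Λ) → Vector (W F) n → Valuation F → Set) →
             (∀ {m} (wk : Fin n → Fin m) rs ps → KrachtDefinable {n = m} (λ F ρ → ∀ θ →
               Regular F ρ θ rs → Refutes F ρ θ ps → Rest F (ρ ∘ wk) θ → ⊥)) →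
             ∀ rs ps → KrachtDefinable (λ F ρ → ∀ θ →
               Regular F ρ θ rs → Refutes F ρ θ ps → (F , ρ x , θ ⊩ φ) → Rest F ρ θ → ⊥)
kracht-gsa (reg r) x Rest K rs ps = kracht-resp
  (λ F ρ → mk⇔ (λ f θ a b c d → f θ (c ∷ a) b d) (λ { f θ (c ∷ a) b d → f θ a b c d }))
  (K id ((x , _ , _ , r) ∷ rs) ps)
kracht-gsa (neg s) x Rest K rs ps = kracht-resp
  (λ F ρ → mk⇔ (λ f θ a b c d → f θ a (c ∷ b) d) (λ { f θ a (c ∷ b) d → f θ a b c d }))
  (K id rs ((x , _ , s) ∷ ps))
kracht-gsa (_∧ᵐ_ {ψ = ψ} g h) x Rest K rs ps = kracht-resp
  (λ F ρ → mk⇔ (λ f θ a b (c , d) e → f θ a b c (d , e)) (λ f θ a b c (d , e) → f θ a b (c , d) e))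
  -- The second conjunct waits in `Rest`, since unfolding the first may split into cases and bind
  -- variables; it is unfolded inside each case.
  (kracht-gsa g x (λ F ρ θ → (F , ρ x , θ ⊩ ψ) × Rest F ρ θ)
    (λ wk rs′ ps′ → kracht-resp
      (λ F ρ → mk⇔ (λ f θ a b (c , d) → f θ a b c d) (λ f θ a b c d → f θ a b (c , d)))
      (kracht-gsa h (wk x) (λ F ρ → Rest F (ρ ∘ wk)) (λ wk′ → K (wk′ ∘ wk)) rs′ ps′))
    rs ps)
kracht-gsa (g ∨ᵐ h) x Rest K rs ps = kracht-resp
  (λ F ρ → mk⇔
    (λ { (f , f′) θ a b (inj₁ c) → f θ a b c ; (f , f′) θ a b (inj₂ c) → f′ θ a b c })
    (λ f → (λ θ a b c → f θ a b (inj₁ c)) , (λ θ a b c → f θ a b (inj₂ c))))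
  (kracht-∧ (kracht-gsa g x Rest K rs ps) (kracht-gsa h x Rest K rs ps))
kracht-gsa (◇ l g) x Rest K rs ps = kracht-resp
  (λ F ρ → mk⇔
    (λ f θ a b (w , r , c) → f w r θ (map⁺ a) (map⁺ b) c)
    (λ f w r θ a b c → f θ (map⁻ a) (map⁻ b) (w , r , c)))
  (kracht-∀ l x (kracht-gsa g zero (λ F ρ → Rest F (ρ ∘ suc)) (λ wk → K (wk ∘ suc))
    (map (map₁ suc) rs) (map (map₁ suc) ps)))

Valid : Modal Λ → Fin n → Property Λ n (lsuc 0ℓ)
Valid φ x F ρ = ∀ θ → F , ρ x , θ ⊩ φ

kracht-sahlqvist : ExcludedMiddle 0ℓ → {φ : Modal Λ} → GenSahlqvist φ → (x : Fin n) →
                   KrachtDefinable (Valid φ x)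
kracht-sahlqvist em (imp g) x = kracht-resp
  (λ F ρ → mk⇔ (λ f θ h → f θ [] [] h tt) (λ f θ _ _ h _ → f θ h))
  (kracht-gsa g x (λ _ _ _ → ⊤)
    (λ wk rs ps → kracht-resp (λ F ρ → mk⇔ (λ f θ a b _ → f θ a b) (λ f θ a b → f θ a b tt))
      (kracht-unsatisfiable em (wk x) rs ps))
    [] [])
kracht-sahlqvist em (□ l s) x = kracht-resp
  (λ F ρ → mk⇔ (λ f θ w r → f w r θ) (λ f w r θ → f θ w r))
  (kracht-∀ l x (kracht-sahlqvist em s zero))
kracht-sahlqvist em (s ∧ᵐ t) x = kracht-resp
  (λ F ρ → mk⇔ (λ (f , g) θ → f θ , g θ) (λ f → proj₁ ∘ f , proj₂ ∘ f))
  (kracht-∧ (kracht-sahlqvist em s x) (kracht-sahlqvist em t x))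
kracht-sahlqvist em (disj {φ} {ψ} apart s t) x = record
  { formula    = formula (kracht-∨ ds dt)
  ; restricted = restricted (kracht-∨ ds dt)
  ; universal  = universal (kracht-∨ ds dt)
  ; correct    = λ F ρ → mk⇔
      [ (λ u θ → inj₁ (to (correct ds F ρ) u θ)) , (λ u θ → inj₂ (to (correct dt F ρ) u θ)) ]′
      (split F ρ)
  }
  where
  ds = kracht-sahlqvist em s x
  dt = kracht-sahlqvist em t x
  split : ∀ F ρ → (∀ θ → F , ρ x , θ ⊩ φ ∨ᵐ ψ) →
          (F , ρ ⊨ expand (formula ds)) ⊎ (F , ρ ⊨ expand (formula dt))
  -- The case distinction is on the first-order equivalent of validity, which lies in `Set`.
  split F ρ f with em {F , ρ ⊨ expand (formula ds)}
  ... | yes u = inj₁ u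
  -- If `η` refuted `ψ`, gluing it to an arbitrary `θ` on the variables of `φ` would make `φ` true
  -- under every `θ`.
  ... | no ¬u = inj₂ (from (correct dt F ρ) λ η →
    decidable-stable em λ ¬ψ → ¬u (from (correct ds F ρ) λ θ →
      [ to (ifᵛ-yes (_∈var φ) φ F {θ} {η} (λ _ → id) (ρ x))
      , ⊥-elim ∘ ¬ψ ∘ to (ifᵛ-no (_∈var φ) ψ F {θ} {η} (λ p q r → apart p (r , q)) (ρ x)) ]′
      (f (ifᵛ {F = F} (_∈var φ) θ η))))

-- From Kracht formulas to Sahlqvist formulas

-- Formulas with consecutive half-open rank intervals have no common variable, so disjointness is
-- obtained without renaming.
Between : ℕ → ℕ → Var → Set
Between N N′ p = N ≤ rank p × rank p < N′

record Label (Λ : Set) (N N′ : ℕ) : Set where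
  constructor label
  field
    modal   : Modal Λ
    gsa     : GSA modal
    between : ∀ p → p ∈var modal → Between N N′ p
open Label

_∧ˡ_ : Label Λ N N′ → Label Λ N N′ → Label Λ N N′
label φ g r ∧ˡ label ψ h s = label (φ ∧ᵐ ψ) (g ∧ᵐ h) λ p → [ r p , s p ]′

-- The constant `⊤ᵐ` is not itself a `GSA`, so truth is written as a negative formula.
⊤ˡ : Label Λ N N′
⊤ˡ = label (¬ᵐ ⊥ᵐ) (neg ⊥ᵐ) λ _ ()

◇ˡ : Λ → Label Λ N N′ → Label Λ N N′
◇ˡ l (label φ g r) = label (◇ l φ) (◇ l g) r

-- A clause states that no valuation makes every variable satisfy its label.
Clause : Set → ℕ → ℕ → ℕ → Set
Clause Λ n N N′ = Vector (Label Λ N N′) n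

Satisfies : (F : Frame Λ) → Vector (W F) n → Valuation F → Clause Λ n N N′ → Set
Satisfies F ρ θ c = ∀ i → F , ρ i , θ ⊩ modal (c i)

Refuted : (F : Frame Λ) → Vector (W F) n → Clause Λ n N N′ → Set₁
Refuted F ρ c = ∀ θ → ¬ Satisfies F ρ θ c

widenˡ : N′ ≤ N″ → Label Λ N N′ → Label Λ N N″
widenˡ le (label φ g r) = label φ g λ p v → map₂ (λ lt → ≤-trans lt le) (r p v)

widenʳ : N ≤ N′ → Label Λ N′ N″ → Label Λ N N″
widenʳ le (label φ g r) = label φ g λ p v → map₁ (≤-trans le) (r p v)

attach : Fin n → Label Λ N N′ → Clause Λ n N N′ → Clause Λ n N N′
attach x g c = updateAt c x (_∧ˡ g)

attach-correct : (x : Fin n) (g : Label Λ N N′) (c : Clause Λ n N N′) (F : Frame Λ)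
                 (ρ : Vector (W F) n) (θ : Valuation F) →
                 Satisfies F ρ θ (attach x g c) ⇔ (Satisfies F ρ θ c × (F , ρ x , θ ⊩ modal g))
attach-correct zero g c F ρ θ = mk⇔
  (λ h → (λ { zero → proj₁ (h zero) ; (suc i) → h (suc i) }) , proj₂ (h zero))
  (λ { (h , u) zero → h zero , u ; (h , u) (suc i) → h (suc i) })
attach-correct (suc x) g c F ρ θ = mk⇔
  (λ h → map₁ (λ { f zero → h zero ; f (suc i) → f i }) (to e (h ∘ suc)))
  (λ { (h , u) zero → h zero ; (h , u) (suc i) → from e (h ∘ suc , u) i })
  where e = attach-correct x g (c ∘ suc) F (ρ ∘ suc) θ

-- A stage keeps a clause together with the least valuation satisfying
-- its labels.
record Stage (Λ : Set) (n N : ℕ) : Set₁ where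
  field
    top     : ℕ
    N≤top   : N ≤ top
    clause  : Clause Λ n N top
    val     : (F : Frame Λ) → Vector (W F) n → Valuation F
    models  : ∀ F ρ → Satisfies F ρ (val F ρ) clause
    minimum : ∀ F ρ {θ} → Satisfies F ρ θ clause → ∀ p → rank p < top → ∀ y → val F ρ p y → θ p y
open Stage

-- Later stages only settle variables of higher rank, so codes found earlier keep their meaning.
record _≼_ (Γ Δ : Stage Λ n N) : Set₁ where
  field
    below : top Γ ≤ top Δ
    agree : ∀ F ρ p → rank p < top Γ → ∀ y → val Γ F ρ p y ⇔ val Δ F ρ p y
open _≼_

≼-refl : {Γ : Stage Λ n N} → Γ ≼ Γ
≼-refl = record { below = ≤-refl ; agree = λ _ _ _ _ _ → ⇔-id _ }

≼-trans : {Γ Δ Θ : Stage Λ n N} → Γ ≼ Δ → Δ ≼ Θ → Γ ≼ Θ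
≼-trans s t = record
  { below = ≤-trans (below s) (below t)
  ; agree = λ F ρ p lt y → agree t F ρ p (≤-trans lt (below s)) y ⇔-∘ agree s F ρ p lt y
  }

record Encoding (Γ : Stage Λ n N) (E : Expr Λ n) : Set₁ where
  field
    after    : Stage Λ n N
    extends  : Γ ≼ after
    code     : Modal Λ
    positive : Positive code
    ranks    : ∀ p → p ∈var code → Between N (top after) p
    denotes  : ∀ F ρ y → (F , y , val after F ρ ⊩ code) ⇔ ⟦ E ⟧ F ρ y

-- wrap φ at the variable root states that φ holds on all of A.
record Spine (Γ : Stage Λ n N) (A : Expr Λ n) : Set₁ where
  field
    after   : Stage Λ n N
    extends : Γ ≼ after
    root    : Fin n
    wrap    : Modal Λ → Modal Λ
    regular : ∀ {k φ} → top after ≤ k → RegularBox k φ → RegularBox k (wrap φ)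
    ranks   : ∀ φ p → p ∈var wrap φ → p ∈var φ ⊎ Between N (top after) p
    intro   : ∀ F ρ {θ : Valuation F} φ →
              (∀ p → rank p < top after → ∀ y → θ p y → val after F ρ p y) →
              (∀ y → ⟦ A ⟧ F ρ y → F , y , θ ⊩ φ) → F , ρ root , θ ⊩ wrap φ
    elim    : ∀ F ρ {θ : Valuation F} φ →
              (∀ p → rank p < top after → ∀ y → val after F ρ p y → θ p y) →
              (F , ρ root , θ ⊩ wrap φ) → ∀ y → ⟦ A ⟧ F ρ y → F , y , θ ⊩ φ

-- The label `wrap (var q)` at `root` says that `q` holds on all of `A`. Nothing else constrains
-- `q`, so its least value is `A`.
allocate : {Γ : Stage Λ n N} {A : Expr Λ n} → Spine Γ A → Encoding Γ A
allocate {Λ} {n} {N} {Γ} {A} s = record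
  { after    = Θ
  ; extends  = ≼-trans extends Δ≼Θ
  ; code     = var q
  ; positive = var q
  ; ranks    = λ { _ refl → N≤top Δ , ≤-refl }
  ; denotes  = λ F ρ y → mk⇔
      (λ { (inj₁ (lt , _)) → ⊥-elim (<-irrefl refl lt) ; (inj₂ (_ , u)) → u })
      (λ u → inj₂ (refl , u))
  }
  where
  open Spine s renaming (after to Δ)
  -- The rank exceeds that of every antecedent in `wrap`. Each allocation raises `top`, so one index
  -- per rank is enough.
  q = mkVar (top Δ) 0
  val′ : (F : Frame Λ) → Vector (W F) n → Valuation F
  val′ F ρ p y = (rank p < top Δ × val Δ F ρ p y) ⊎ (p ≡ q × ⟦ A ⟧ F ρ y)
  old : ∀ F ρ p → rank p < top Δ → ∀ y → val Δ F ρ p y ⇔ val′ F ρ p y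
  old F ρ p lt y = mk⇔ (λ u → inj₁ (lt , u))
    λ { (inj₁ (_ , u)) → u ; (inj₂ (refl , _)) → ⊥-elim (<-irrefl refl lt) }
  widened : Clause Λ n N (suc (top Δ))
  widened = widenˡ (n≤1+n _) ∘ clause Δ
  new : Label Λ N (suc (top Δ))
  new = label (wrap (var q)) (reg (regular ≤-refl (var 0))) λ p v →
    [ (λ { refl → N≤top Δ , ≤-refl }) , map₂ (λ lt → ≤-trans lt (n≤1+n _)) ]′ (ranks (var q) p v)
  Θ : Stage Λ n N
  Θ = record
    { top     = suc (top Δ)
    ; N≤top   = ≤-trans (N≤top Δ) (n≤1+n _)
    ; clause  = attach root new widened
    ; val     = val′
    ; models  = λ F ρ → from (attach-correct root new widened F ρ _)
        ( (λ i → to (⊩-cong (modal (clause Δ i)) F (λ p v → old F ρ p (proj₂ (between (clause Δ i) p v))) (ρ i))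
                    (models Δ F ρ i))
        , intro F ρ (var q) (λ p lt y → from (old F ρ p lt y)) (λ y u → inj₂ (refl , u)) )
    ; minimum = λ F ρ h → let (u , w) = to (attach-correct root new widened F ρ _) h in λ
        { p _ y (inj₁ (lt , v)) → minimum Δ F ρ u p lt y v
        ; p _ y (inj₂ (refl , v)) → elim F ρ (var q) (minimum Δ F ρ u) w y v }
    }
  Δ≼Θ : Δ ≼ Θ
  Δ≼Θ = record { below = n≤1+n _ ; agree = old }

transport : {Γ : Stage Λ n N} {A : Expr Λ n} (e : Encoding Γ A) {Δ : Stage Λ n N} →
            Encoding.after e ≼ Δ → Encoding Γ A
transport e {Δ} s = record
  { after    = Δ
  ; extends  = ≼-trans extends s
  ; code     = code
  ; positive = positive
  ; ranks    = λ p v → map₂ (λ lt → ≤-trans lt (below s)) (ranks p v)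
  ; denotes  = λ F ρ y → denotes F ρ y ⇔-∘
      ⇔-sym (⊩-cong code F (λ p v → agree s F ρ p (proj₂ (ranks p v))) y)
  }
  where open Encoding e

-- The second operand is encoded from the stage reached by the first, whose code is then
-- transported, so that both are read at one valuation.
combine : {Γ : Stage Λ n N} {A B : Expr Λ n} (_⊙_ : Modal Λ → Modal Λ → Modal Λ) (E : Expr Λ n) →
          (∀ {φ ψ} → Positive φ → Positive ψ → Positive (φ ⊙ ψ)) →
          (∀ {φ ψ} p → p ∈var φ ⊙ ψ → p ∈var φ ⊎ p ∈var ψ) →
          (∀ {φ ψ} F ρ (θ : Valuation F) y →
            (F , y , θ ⊩ φ) ⇔ ⟦ A ⟧ F ρ y → (F , y , θ ⊩ ψ) ⇔ ⟦ B ⟧ F ρ y →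
            (F , y , θ ⊩ (φ ⊙ ψ)) ⇔ ⟦ E ⟧ F ρ y) →
          Encoding Γ A → (∀ Δ → Encoding Δ B) → Encoding Γ E
combine _⊙_ E pos vars sem e f = record
  { after    = after
  ; extends  = Encoding.extends e′
  ; code     = Encoding.code e ⊙ code
  ; positive = pos (Encoding.positive e) positive
  ; ranks    = λ p v → [ Encoding.ranks e′ p , ranks p ]′ (vars p v)
  ; denotes  = λ F ρ y → sem F ρ _ y (Encoding.denotes e′ F ρ y) (denotes F ρ y)
  }
  where
  open Encoding (f (Encoding.after e))
  e′ = transport e extends

spine-resp : {Γ : Stage Λ n N} {A B : Expr Λ n} → (∀ F ρ y → ⟦ A ⟧ F ρ y ⇔ ⟦ B ⟧ F ρ y) →
             Spine Γ A → Spine Γ B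
spine-resp e s = record
  { Spine s
  ; intro = λ F ρ φ le h → intro F ρ φ le (λ y → h y ∘ to (e F ρ y))
  ; elim  = λ F ρ φ le h y → elim F ρ φ le h y ∘ from (e F ρ y)
  }
  where open Spine s

-- Only `A` needs a root: `φ` holds on the intersection when the code of `B` implies `φ` on `A`.
-- Being an antecedent, that code is compared with the least valuation in opposite directions by
-- `intro` and `elim`.
spine-∩ : {Γ : Stage Λ n N} {A B : Expr Λ n} → Spine Γ A → (∀ Δ → Encoding Δ B) → Spine Γ (A ∩ B)
spine-∩ s f = record
  { after   = E.after
  ; extends = ≼-trans S.extends E.extends
  ; root    = S.root
  ; wrap    = λ φ → S.wrap (E.code ⇒ᵐ φ)
  ; regular = λ le r → S.regular (≤-trans (below E.extends) le)
      (imp E.positive (λ p v → ≤-trans (proj₂ (E.ranks p v)) le) r)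
  ; ranks   = λ φ p v →
      [ [ inj₂ ∘ E.ranks p , inj₁ ]′
      , (λ u → inj₂ (map₂ (λ lt → ≤-trans lt (below E.extends)) u)) ]′ (S.ranks _ p v)
  ; intro   = λ F ρ φ le h → S.intro F ρ _
      (λ p lt y u → from (E.extends .agree F ρ p lt y) (le p (≤-trans lt (below E.extends)) y u))
      (λ y a b → h y (a , to (E.denotes F ρ y)
        (⊩-mono E.positive F (λ p v → le p (proj₂ (E.ranks p v))) y b)))
  ; elim    = λ F ρ φ le h y (a , b) → S.elim F ρ _
      (λ p lt y u → le p (≤-trans lt (below E.extends)) y (to (E.extends .agree F ρ p lt y) u))
      h y a (⊩-mono E.positive F (λ p v → le p (proj₂ (E.ranks p v))) y (from (E.denotes F ρ y) b))
  }
  where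
  module S = Spine s
  module E = Encoding (f S.after)

mutual
  -- Points and images have no positive modal counterpart and receive a fresh variable; the other
  -- operations are positive connectives.
  encode : (E : Expr Λ n) → ImageSafe E → (Γ : Stage Λ n N) → Encoding Γ E
  encode (var i) s Γ = allocate (spine (var i) (var i) s Γ)
  encode ⊤ₑ s Γ = record
    { after = Γ ; extends = ≼-refl ; code = ⊤ᵐ ; positive = ⊤ᵐ
    ; ranks = λ _ () ; denotes = λ _ _ _ → ⇔-id _ }
  encode ⊥ₑ s Γ = record
    { after = Γ ; extends = ≼-refl ; code = ⊥ᵐ ; positive = ⊥ᵐ
    ; ranks = λ _ () ; denotes = λ _ _ _ → ⇔-id _ }
  encode (A ∩ B) s Γ = combine _∧ᵐ_ (A ∩ B) _∧ᵐ_ (λ _ → id) (λ _ _ _ _ → _×-⇔_)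
    (encode A (λ l C → s l C ∘ ∩ˡ) Γ) (encode B (λ l C → s l C ∘ ∩ʳ))
  encode (A ∪ B) s Γ = combine _∨ᵐ_ (A ∪ B) _∨ᵐ_ (λ _ → id) (λ _ _ _ _ → _⊎-⇔_)
    (encode A (λ l C → s l C ∘ ∪ˡ) Γ) (encode B (λ l C → s l C ∘ ∪ʳ))
  encode (R⁻¹ l A) s Γ = record
    { Encoding e
    ; code     = ◇ l (Encoding.code e)
    ; positive = ◇ l (Encoding.positive e)
    ; denotes  = λ F ρ y → ∃-⇔ λ z → ⇔-id _ ×-⇔ Encoding.denotes e F ρ z
    }
    where e = encode A (λ l C → s l C ∘ R⁻¹) Γ
  encode (R□ l A) s Γ = record
    { Encoding e
    ; code     = □ l (Encoding.code e)
    ; positive = □ l (Encoding.positive e)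
    ; denotes  = λ F ρ y → ∀-⇔ λ z → →-cong-⇔ (⇔-id _) (Encoding.denotes e F ρ z)
    }
    where e = encode A (λ l C → s l C ∘ R□) Γ
  encode (Rₑ l A) s Γ = allocate (spine (Rₑ l A) (Rₑ l (s l A here)) s Γ)

  -- Image is left adjoint to box: `φ` holds on `Rₑ l A` exactly when `□ l φ` holds on `A`.
  spine : (A : Expr Λ n) → SafeSub A → ImageSafe A → (Γ : Stage Λ n N) → Spine Γ A
  spine (var i) w s Γ = record
    { after = Γ ; extends = ≼-refl ; root = i ; wrap = id
    ; regular = λ _ r → r ; ranks = λ _ _ → inj₁
    ; intro = λ F ρ φ _ h → h _ refl ; elim = λ { F ρ φ _ h _ refl → h } }
  spine (Rₑ l A) (Rₑ _ w) s Γ = record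
    { Spine t
    ; wrap    = Spine.wrap t ∘ □ l
    ; regular = λ le r → Spine.regular t le (□ l r)
    ; ranks   = λ φ → Spine.ranks t (□ l φ)
    ; intro   = λ F ρ φ le h → Spine.intro t F ρ (□ l φ) le λ z a y r → h y (z , r , a)
    ; elim    = λ { F ρ φ le h y (z , r , a) → Spine.elim t F ρ (□ l φ) le h z a y r }
    }
    where t = spine A w (λ l C → s l C ∘ Rₑ) Γ
  spine (A ∩ B) (∩ˡ w) s Γ =
    spine-∩ (spine A w (λ l C → s l C ∘ ∩ˡ) Γ) (encode B (λ l C → s l C ∘ ∩ʳ))
  spine (A ∩ B) (∩ʳ w) s Γ = spine-resp (λ F ρ y → mk⇔ swap swap)
    (spine-∩ (spine B w (λ l C → s l C ∘ ∩ʳ) Γ) (encode A (λ l C → s l C ∘ ∩ˡ)))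

empty : ∀ N → Stage Λ n N
empty N = record
  { top     = N
  ; N≤top   = ≤-refl
  ; clause  = λ _ → ⊤ˡ
  ; val     = λ _ _ _ _ → ⊥
  ; models  = λ _ _ _ ()
  ; minimum = λ _ _ _ _ _ _ ()
  }

-- Properties definable by refuting clauses

record SahlqvistDefinable {Λ n} (N : ℕ) (P : Property Λ n 0ℓ) : Set₁ where
  field
    top     : ℕ
    N≤top   : N ≤ top
    clauses : List (Clause Λ n N top)
    refutes : ∀ F ρ → P F ρ ⇔ (∀ c → c ∈ clauses → Refuted F ρ c)
open SahlqvistDefinable

sahlqvist-resp : {P Q : Property Λ n 0ℓ} → (∀ F ρ → P F ρ ⇔ Q F ρ) →
                 SahlqvistDefinable N P → SahlqvistDefinable N Q
sahlqvist-resp e d = record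
  { SahlqvistDefinable d
  ; refutes = λ F ρ → refutes d F ρ ⇔-∘ ⇔-sym (e F ρ)
  }

-- The clause asks for a valuation satisfying the labels with the code of `E` false at `x`. Positive
-- codes grow with the valuation, so if there is one, the least valuation is one.
sahlqvist-atom : ExcludedMiddle 0ℓ → ∀ N x (E : Expr Λ n) → ImageSafe E →
                 SahlqvistDefinable N (λ F ρ → ⟦ E ⟧ F ρ (ρ x))
sahlqvist-atom {Λ} {n} em N x E s = record
  { top     = top after
  ; N≤top   = N≤top after
  ; clauses = [ attach x g (clause after) ]
  ; refutes = λ F ρ → mk⇔
      (λ { u _ (here refl) θ h → let (v , w) = to (attach-correct x g (clause after) F ρ θ) h in
        w (⊩-mono positive F (λ p o → minimum after F ρ v p (proj₂ (ranks p o))) (ρ x)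
          (from (denotes F ρ (ρ x)) u)) })
      (λ f → decidable-stable em λ ¬u → f _ (here refl) (val after F ρ)
        (from (attach-correct x g (clause after) F ρ _)
          (models after F ρ , ¬u ∘ to (denotes F ρ (ρ x)))))
  }
  where
  open Encoding (encode E s (empty N))
  g : Label Λ N (top after)
  g = label (¬ᵐ code) (neg positive) ranks

sahlqvist-∧ : {P Q : Property Λ n 0ℓ} → (d : SahlqvistDefinable N P) →
              SahlqvistDefinable (top d) Q → SahlqvistDefinable N (λ F ρ → P F ρ × Q F ρ)
sahlqvist-∧ {Λ} {n} {N} d e = record
  { top     = top e
  ; N≤top   = ≤-trans (N≤top d) (N≤top e)
  ; clauses = map f (clauses d) ++ map g (clauses e)
  ; refutes = λ F ρ → mk⇔
      (λ (u , v) _ i → [ (λ j → let (_ , k , eq) = ∈-map⁻ f j in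
                         subst (Refuted F ρ) (sym eq) (to (refutes d F ρ) u _ k))
                     , (λ j → let (_ , k , eq) = ∈-map⁻ g j in
                         subst (Refuted F ρ) (sym eq) (to (refutes e F ρ) v _ k))
                     ]′ (∈-++⁻ (map f (clauses d)) i))
      (λ h → from (refutes d F ρ) (λ c i → h (f c) (∈-++⁺ˡ (∈-map⁺ f i)))
           , from (refutes e F ρ) (λ c i → h (g c) (∈-++⁺ʳ (map f (clauses d)) (∈-map⁺ g i))))
  }
  where
  f : Clause Λ n N (top d) → Clause Λ n N (top e)
  f = widenˡ (N≤top e) ∘_
  g : Clause Λ n (top d) (top e) → Clause Λ n N (top e)
  g = widenʳ (N≤top d) ∘_

-- The clauses of the disjuncts have no common variables, so two
-- valuations satisfying a clause of each glue to one satisfying both.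
sahlqvist-∨ : ExcludedMiddle 0ℓ → {P Q : Property Λ n 0ℓ} → (d : SahlqvistDefinable N P) →
              SahlqvistDefinable (top d) Q → SahlqvistDefinable N (λ F ρ → P F ρ ⊎ Q F ρ)
sahlqvist-∨ {Λ} {n} {N} em {P} {Q} d e = record
  { top     = top e
  ; N≤top   = ≤-trans (N≤top d) (N≤top e)
  ; clauses = cartesianProductWith both (clauses d) (clauses e)
  ; refutes = λ F ρ → mk⇔
      (λ u _ i → let (_ , _ , j , k , eq) = ∈-cartesianProductWith⁻ both (clauses d) (clauses e) i in
        subst (Refuted F ρ) (sym eq) λ θ h →
          [ (λ v → to (refutes d F ρ) v _ j θ (proj₁ ∘ h))
          , (λ v → to (refutes e F ρ) v _ k θ (proj₂ ∘ h)) ]′ u)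
      (split F ρ)
  }
  where
  both : Clause Λ n N (top d) → Clause Λ n (top d) (top e) → Clause Λ n N (top e)
  both c c′ i = widenˡ (N≤top e) (c i) ∧ˡ widenʳ (N≤top d) (c′ i)
  split : ∀ F ρ → (∀ c → c ∈ cartesianProductWith both (clauses d) (clauses e) → Refuted F ρ c) →
          P F ρ ⊎ Q F ρ
  split F ρ f with em {P F ρ}
  ... | yes u = inj₁ u
  ... | no ¬u = inj₂ (from (refutes e F ρ) λ c′ j η h′ →
    ¬u (from (refutes d F ρ) λ c i θ h →
      f (both c c′) (∈-cartesianProductWith⁺ both i j) (ifᵛ {F = F} (λ p → rank p < top d) θ η) λ k →
        from (ifᵛ-yes _ (modal (c k)) F (λ p v → proj₂ (between (c k) p v)) (ρ k)) (h k) ,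
        from (ifᵛ-no _ (modal (c′ k)) F (λ p v lt → <⇒≱ lt (proj₁ (between (c′ k) p v))) (ρ k)) (h′ k)))

-- Quantifiers over points and over valuations commute, and a successor satisfying the label of the
-- bound variable is a diamond in the label of `x`.
sahlqvist-∀ : ∀ l x {P : Property Λ (suc n) 0ℓ} → SahlqvistDefinable N P →
              SahlqvistDefinable N (λ F ρ → ∀ w → R F l (ρ x) w → P F (w ∷ᶠ ρ))
sahlqvist-∀ {Λ} {n} {N} l x d = record
  { top     = top d
  ; N≤top   = N≤top d
  ; clauses = map f (clauses d)
  ; refutes = λ F ρ → mk⇔
      (λ u _ i → let (c , j , eq) = ∈-map⁻ f i in
        subst (Refuted F ρ) (sym eq) λ θ h →
          let (v , w , r , z) = to (attach-correct x (◇ˡ l (c zero)) (c ∘ suc) F ρ θ) h in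
          to (refutes d F (w ∷ᶠ ρ)) (u w r) c j θ λ { zero → z ; (suc k) → v k })
      (λ h w r → from (refutes d F (w ∷ᶠ ρ)) λ c i θ g → h (f c) (∈-map⁺ f i) θ
        (from (attach-correct x (◇ˡ l (c zero)) (c ∘ suc) F ρ θ) (g ∘ suc , w , r , g zero)))
  }
  where
  f : Clause Λ (suc n) N (top d) → Clause Λ n N (top d)
  f c = attach x (◇ˡ l (c zero)) (c ∘ suc)

-- Absorbing quantifiers into expressions

-- Positive Boolean combinations of memberships v ∈ E, with v among m
-- variables and E over n variables.
data Combination (Λ : Set) (m n : ℕ) : Set where
  mem       : Fin m → (E : Expr Λ n) → ImageSafe E → Combination Λ m n
  _∧ᶜ_ _∨ᶜ_ : Combination Λ m n → Combination Λ m n → Combination Λ m n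

Holds : Combination Λ m n → (F : Frame Λ) → Vector (W F) n → Vector (W F) m → Set
Holds (mem i E _) F ρ σ = ⟦ E ⟧ F ρ (σ i)
Holds (p ∧ᶜ q)    F ρ σ = Holds p F ρ σ × Holds q F ρ σ
Holds (p ∨ᶜ q)    F ρ σ = Holds p F ρ σ ⊎ Holds q F ρ σ

SafeExpr : Set → ℕ → Set
SafeExpr Λ n = ∃[ E ] ImageSafe {Λ} {n} E

-- The accumulated expression collects the conjuncts about the bound
-- variable while a disjunctive normal form is traversed.
∃-elim : Combination Λ (suc m) n → (SafeExpr Λ n → Combination Λ m n) →
         SafeExpr Λ n → Combination Λ m n
∃-elim (mem zero B t)    K (A , s) = K (A ∩ B , s ∩ⁱ t)
∃-elim (mem (suc i) B t) K A       = mem i B t ∧ᶜ K A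
∃-elim (p ∧ᶜ q)          K         = ∃-elim p (∃-elim q K)
∃-elim (p ∨ᶜ q)          K A       = ∃-elim p K A ∨ᶜ ∃-elim q K A

-- `Rest` is what the continuation still demands of the witness: the restriction of the quantifier,
-- and the second conjunct while the first is traversed.
∃-elim-correct : (p : Combination Λ (suc m) n) (K : SafeExpr Λ n → Combination Λ m n)
                 (F : Frame Λ) (ρ : Vector (W F) n) (σ : Vector (W F) m) (Rest : W F → Set) →
                 (∀ A → Holds (K A) F ρ σ ⇔ (∃[ w ] ⟦ proj₁ A ⟧ F ρ w × Rest w)) →
                 ∀ A → Holds (∃-elim p K A) F ρ σ ⇔
                       (∃[ w ] ⟦ proj₁ A ⟧ F ρ w × Holds p F ρ (w ∷ᶠ σ) × Rest w)
∃-elim-correct (mem zero B t) K F ρ σ Rest e (A , s) =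
  mk⇔ (λ { (w , (u , v) , r) → w , u , v , r }) (λ { (w , u , v , r) → w , (u , v) , r })
  ⇔-∘ e (A ∩ B , s ∩ⁱ t)
∃-elim-correct (mem (suc i) B t) K F ρ σ Rest e A = mk⇔
  (λ (v , k) → let (w , u , r) = to (e A) k in w , u , v , r)
  (λ (w , u , v , r) → v , from (e A) (w , u , r))
∃-elim-correct (p ∧ᶜ q) K F ρ σ Rest e A =
  mk⇔ (λ { (w , u , v , v′ , r) → w , u , (v , v′) , r })
      (λ { (w , u , (v , v′) , r) → w , u , v , v′ , r })
  ⇔-∘ ∃-elim-correct p (∃-elim q K) F ρ σ _ (∃-elim-correct q K F ρ σ Rest e) A
∃-elim-correct (p ∨ᶜ q) K F ρ σ Rest e A =
  mk⇔ (λ { (inj₁ (w , u , v , r)) → w , u , inj₁ v , r ; (inj₂ (w , u , v , r)) → w , u , inj₂ v , r })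
      (λ { (w , u , inj₁ v , r) → inj₁ (w , u , v , r) ; (w , u , inj₂ v , r) → inj₂ (w , u , v , r) })
  ⇔-∘ (∃-elim-correct p K F ρ σ Rest e A ⊎-⇔ ∃-elim-correct q K F ρ σ Rest e A)

-- Dually, disjuncts about the bound variable are collected along a conjunctive normal form.
∀-elim : Combination Λ (suc m) n → (SafeExpr Λ n → Combination Λ m n) →
         SafeExpr Λ n → Combination Λ m n
∀-elim (mem zero B t)    K (A , s) = K (A ∪ B , s ∪ⁱ t)
∀-elim (mem (suc i) B t) K A       = mem i B t ∨ᶜ K A
∀-elim (p ∨ᶜ q)          K         = ∀-elim p (∀-elim q K)
∀-elim (p ∧ᶜ q)          K A       = ∀-elim p K A ∧ᶜ ∀-elim q K A

∀-elim-correct : ExcludedMiddle 0ℓ →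
                 (p : Combination Λ (suc m) n) (K : SafeExpr Λ n → Combination Λ m n)
                 (F : Frame Λ) (ρ : Vector (W F) n) (σ : Vector (W F) m) (Rest : W F → Set) →
                 (∀ A → Holds (K A) F ρ σ ⇔ (∀ w → ⟦ proj₁ A ⟧ F ρ w ⊎ Rest w)) →
                 ∀ A → Holds (∀-elim p K A) F ρ σ ⇔
                       (∀ w → ⟦ proj₁ A ⟧ F ρ w ⊎ Holds p F ρ (w ∷ᶠ σ) ⊎ Rest w)
∀-elim-correct em (mem zero B t) K F ρ σ Rest e (A , s) =
  (∀-⇔ λ w → mk⇔ assocʳ assocˡ) ⇔-∘ e (A ∪ B , s ∪ⁱ t)
∀-elim-correct em (mem (suc i) B t) K F ρ σ Rest e A = mk⇔
  (λ { (inj₁ v) w → inj₂ (inj₁ v) ; (inj₂ k) w → [ inj₁ , inj₂ ∘ inj₂ ]′ (to (e A) k w) })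
  -- Pulling a disjunct independent of `w` out of the universal quantifier is the classical step.
  (λ f → [ inj₁ , (λ ¬v → inj₂ (from (e A) λ w →
    [ inj₁ , [ ⊥-elim ∘ ¬v , inj₂ ]′ ]′ (f w))) ]′ (toSum em))
∀-elim-correct em (p ∨ᶜ q) K F ρ σ Rest e A =
  (∀-⇔ λ w → ⇔-id _ ⊎-⇔ mk⇔ assocˡ assocʳ)
  ⇔-∘ ∀-elim-correct em p (∀-elim q K) F ρ σ _ (∀-elim-correct em q K F ρ σ Rest e) A
∀-elim-correct em (p ∧ᶜ q) K F ρ σ Rest e A =
  mk⇔ (λ (f , g) w → merge (f w) (g w))
      (λ f → (λ w → [ inj₁ , [ inj₂ ∘ inj₁ ∘ proj₁ , inj₂ ∘ inj₂ ]′ ]′ (f w))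
           , (λ w → [ inj₁ , [ inj₂ ∘ inj₁ ∘ proj₂ , inj₂ ∘ inj₂ ]′ ]′ (f w)))
  ⇔-∘ (∀-elim-correct em p K F ρ σ Rest e A ×-⇔ ∀-elim-correct em q K F ρ σ Rest e A)
  where
  merge : {A B C D : Set} → A ⊎ B ⊎ D → A ⊎ C ⊎ D → A ⊎ (B × C) ⊎ D
  merge (inj₁ a) _ = inj₁ a
  merge (inj₂ (inj₂ d)) _ = inj₂ (inj₂ d)
  merge (inj₂ (inj₁ b)) (inj₁ a) = inj₁ a
  merge (inj₂ (inj₁ b)) (inj₂ (inj₁ c)) = inj₂ (inj₁ (b , c))
  merge (inj₂ (inj₁ b)) (inj₂ (inj₂ d)) = inj₂ (inj₂ d)

rename : (Fin m → Fin n) → Expr Λ m → Expr Λ n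
rename r (var i)   = var (r i)
rename r ⊤ₑ        = ⊤ₑ
rename r ⊥ₑ        = ⊥ₑ
rename r (A ∩ B)   = rename r A ∩ rename r B
rename r (A ∪ B)   = rename r A ∪ rename r B
rename r (R⁻¹ l A) = R⁻¹ l (rename r A)
rename r (R□ l A)  = R□ l (rename r A)
rename r (Rₑ l A)  = Rₑ l (rename r A)

rename-safeSub : (r : Fin m → Fin n) {A : Expr Λ m} → SafeSub A → SafeSub (rename r A)
rename-safeSub r (var i)  = var (r i)
rename-safeSub r (Rₑ l w) = Rₑ l (rename-safeSub r w)
rename-safeSub r (∩ˡ w)   = ∩ˡ (rename-safeSub r w)
rename-safeSub r (∩ʳ w)   = ∩ʳ (rename-safeSub r w)

rename-imageSafe : (r : Fin m → Fin n) (A : Expr Λ m) → ImageSafe A → ImageSafe (rename r A)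
rename-imageSafe r (var i)   s _ _ ()
rename-imageSafe r ⊤ₑ        s _ _ ()
rename-imageSafe r ⊥ₑ        s _ _ ()
rename-imageSafe r (A ∩ B)   s =
  rename-imageSafe r A (λ l C → s l C ∘ ∩ˡ) ∩ⁱ rename-imageSafe r B (λ l C → s l C ∘ ∩ʳ)
rename-imageSafe r (A ∪ B)   s =
  rename-imageSafe r A (λ l C → s l C ∘ ∪ˡ) ∪ⁱ rename-imageSafe r B (λ l C → s l C ∘ ∪ʳ)
rename-imageSafe r (R⁻¹ l A) s = R⁻¹ⁱ (rename-imageSafe r A (λ l C → s l C ∘ R⁻¹))
rename-imageSafe r (R□ l A)  s = R□ⁱ (rename-imageSafe r A (λ l C → s l C ∘ R□))
rename-imageSafe r (Rₑ l A)  s =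
  Rₑⁱ (rename-safeSub r (s l A here)) (rename-imageSafe r A (λ l C → s l C ∘ Rₑ))

rename-correct : (r : Fin m → Fin n) (A : Expr Λ m) (F : Frame Λ)
                 {ρ : Vector (W F) n} {σ : Vector (W F) m} →
                 (∀ i → i occursIn A → ρ (r i) ≡ σ i) → ∀ y →
                 ⟦ A ⟧ F σ y ⇔ ⟦ rename r A ⟧ F ρ y
rename-correct r (var i)   F e y = mk⇔ (λ h → trans h (sym (e i refl))) (λ h → trans h (e i refl))
rename-correct r ⊤ₑ        F e y = ⇔-id _
rename-correct r ⊥ₑ        F e y = ⇔-id _
rename-correct r (A ∩ B)   F e y =
  rename-correct r A F (λ i → e i ∘ inj₁) y ×-⇔ rename-correct r B F (λ i → e i ∘ inj₂) y
rename-correct r (A ∪ B)   F e y =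
  rename-correct r A F (λ i → e i ∘ inj₁) y ⊎-⇔ rename-correct r B F (λ i → e i ∘ inj₂) y
rename-correct r (R⁻¹ l A) F e y = ∃-⇔ λ z → ⇔-id _ ×-⇔ rename-correct r A F e z
rename-correct r (R□ l A)  F e y = ∀-⇔ λ z → →-cong-⇔ (⇔-id _) (rename-correct r A F e z)
rename-correct r (Rₑ l A)  F e y = ∃-⇔ λ z → ⇔-id _ ×-⇔ rename-correct r A F e z

-- r sends the variables in U, the inherently universal ones, to the
-- outer context; its other values are irrelevant.
combination : (r : Fin m → Fin n) {α : ExtFO Λ m} → RestrictedlyPositive α → Combination Λ m n
combination r (atom a) =
  mem (point a) (rename r (expr a)) (rename-imageSafe r (expr a) (images (safe a)))
combination r (s ∧ᶠ t) = combination r s ∧ᶜ combination r t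
combination r (s ∨ᶠ t) = combination r s ∨ᶜ combination r t
combination r (all▷ l x s) =
  -- The accumulator starts at the unit of union, and of intersection for `ex▷`. The bound variable
  -- is not inherently universal, so `r x` is a mere default for it.
  ∀-elim (combination (r x ∷ᶠ r) s) (λ (A , i) → mem x (R□ l A) (R□ⁱ i)) (⊥ₑ , λ _ _ ())
combination r (ex▷ l x s) =
  ∃-elim (combination (r x ∷ᶠ r) s) (λ (A , i) → mem x (R⁻¹ l A) (R⁻¹ⁱ i)) (⊤ₑ , λ _ _ ())

agree-suc : {A : Set} {U : Subset m} {r : Fin m → Fin n} {ρ : Vector A n} {σ : Vector A m}
            {i : Fin n} {w : A} →
            (∀ j → j ∈ₛ U → ρ (r j) ≡ σ j) →
            ∀ j → j ∈ₛ (false ∷ U) → ρ ((i ∷ᶠ r) j) ≡ (w ∷ᶠ σ) j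
agree-suc e (suc j) (there u) = e j u

combination-correct : ExcludedMiddle 0ℓ → (U : Subset m) (r : Fin m → Fin n) {α : ExtFO Λ m}
                      (s : RestrictedlyPositive α) → AtomsUniversal true U s →
                      (F : Frame Λ) {ρ : Vector (W F) n} {σ : Vector (W F) m} →
                      (∀ i → i ∈ₛ U → ρ (r i) ≡ σ i) →
                      Holds (combination r s) F ρ σ ⇔ (F , σ ⊨ expand α)
combination-correct em U r (atom a) au F {σ = σ} e =
  ⇔-sym (rename-correct r (expr a) F (λ i → e i ∘ au i) (σ (point a))
         ⇔-∘ ∈♯-correct (expr a) id (point a) F σ)
combination-correct em U r (s ∧ᶠ t) (au , av) F e =
  combination-correct em U r s au F e ×-⇔ combination-correct em U r t av F e
combination-correct em U r (s ∨ᶠ t) (au , av) F e =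
  combination-correct em U r s au F e ⊎-⇔ combination-correct em U r t av F e
combination-correct em U r (all▷ l x s) au F {ρ} {σ} e =
  mk⇔ (λ f w q → [ ⊥-elim , [ to (ih w) , (λ ¬q → ⊥-elim (¬q q)) ]′ ]′ (f w))
      (λ f w → [ (λ q → inj₂ (inj₁ (from (ih w) (f w q)))) , inj₂ ∘ inj₂ ]′ (toSum em))
  -- The restriction becomes a negated disjunct, which `R□ l` finally absorbs.
  ⇔-∘ ∀-elim-correct em (combination (r x ∷ᶠ r) s) _ F ρ σ (λ w → ¬ R F l (σ x) w)
        (λ A → mk⇔ (λ f w → [ inj₁ ∘ f w , inj₂ ]′ (toSum em))
                   (λ f w q → [ id , (λ ¬q → ⊥-elim (¬q q)) ]′ (f w)))
        _
  where ih = λ w → combination-correct em (false ∷ U) (r x ∷ᶠ r) s au F (agree-suc {r = r} {ρ} {i = r x} {w} e)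
combination-correct em U r (ex▷ l x s) au F {ρ} {σ} e =
  (∃-⇔ λ w → mk⇔ (λ (_ , u , q) → q , to (ih w) u) (λ (q , u) → tt , from (ih w) u , q))
  ⇔-∘ ∃-elim-correct (combination (r x ∷ᶠ r) s) _ F ρ σ (λ w → R F l (σ x) w)
        (λ A → ∃-⇔ λ w → mk⇔ swap swap) _
  where ih = λ w → combination-correct em (false ∷ U) (r x ∷ᶠ r) s au F (agree-suc {r = r} {ρ} {i = r x} {w} e)

-- Assembling the Sahlqvist formula

sahlqvist-combination : ExcludedMiddle 0ℓ → ∀ N (p : Combination Λ n n) →
                        SahlqvistDefinable N (λ F ρ → Holds p F ρ ρ)
sahlqvist-combination em N (mem i E s) = sahlqvist-atom em N i E s
sahlqvist-combination em N (p ∧ᶜ q) =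
  sahlqvist-∧ (sahlqvist-combination em N p) (sahlqvist-combination em _ q)
sahlqvist-combination em N (p ∨ᶜ q) =
  sahlqvist-∨ em (sahlqvist-combination em N p) (sahlqvist-combination em _ q)

-- Down to the first existential quantifier every variable in scope is inherently universal, so the
-- set stays `full` and the renaming there is `id`.
sahlqvist-kracht : ExcludedMiddle 0ℓ → ∀ N {α : ExtFO Λ n} (s : RestrictedlyPositive α) →
                   AtomsUniversal false full s →
                   SahlqvistDefinable N (λ F ρ → F , ρ ⊨ expand α)
sahlqvist-kracht em N (atom a) au = sahlqvist-resp
  (λ F ρ → ⇔-sym (∈♯-correct (expr a) id (point a) F ρ))
  (sahlqvist-atom em N (point a) (expr a) (images (safe a)))
sahlqvist-kracht em N (s ∧ᶠ t) (au , av) =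
  sahlqvist-∧ (sahlqvist-kracht em N s au) (sahlqvist-kracht em _ t av)
sahlqvist-kracht em N (s ∨ᶠ t) (au , av) =
  sahlqvist-∨ em (sahlqvist-kracht em N s au) (sahlqvist-kracht em _ t av)
sahlqvist-kracht em N (all▷ l x s) au = sahlqvist-∀ l x (sahlqvist-kracht em N s au)
sahlqvist-kracht em N (ex▷ l x s) au = sahlqvist-resp
  (λ F ρ → combination-correct em full id (ex▷ l x s) au F (λ _ _ → refl))
  (sahlqvist-combination em N (combination id (ex▷ l x s)))

implications : List (Clause Λ 1 N N′) → Modal Λ
-- The empty conjunction has to be a valid generalized Sahlqvist implication.
implications []       = ¬ᵐ ⊤ᵐ ⇒ᵐ ⊥ᵐ
implications (c ∷ cs) = (modal (c zero) ⇒ᵐ ⊥ᵐ) ∧ᵐ implications cs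

implications-sahlqvist : (cs : List (Clause Λ 1 N N′)) → GenSahlqvist (implications cs)
implications-sahlqvist []       = imp (neg ⊤ᵐ)
implications-sahlqvist (c ∷ cs) = imp (gsa (c zero)) ∧ᵐ implications-sahlqvist cs

implications-correct : (cs : List (Clause Λ 1 N N′)) (F : Frame Λ) (w : W F) →
                       (∀ c → c ∈ cs → Refuted F (λ _ → w) c) ⇔
                       (∀ θ → F , w , θ ⊩ implications cs)
implications-correct []       F w = mk⇔ (λ _ _ f → f tt) (λ _ _ ())
implications-correct (c ∷ cs) F w = mk⇔
  (λ f θ → (λ h → f c (here refl) θ λ { zero → h }) , to (implications-correct cs F w) (λ d → f d ∘ there) θ)
  (λ f → λ { _ (here refl) θ h → proj₁ (f θ) (h zero)
           ; d (there i) → from (implications-correct cs F w) (proj₂ ∘ f) d i })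

theorem30 : ExcludedMiddle 0ℓ → (Λ : Set) (α : ExtFO Λ 1) → OneFree α →
    (∃[ φ ] (GenSahlqvist φ × (α Corresponds φ))) ⇔
    (∃[ β ] (GenKracht β × (α ≋ β)))
theorem30 em Λ α _ = mk⇔
  (λ (φ , s , corr) →
    -- The conjunct x₀ ∈ x₀ makes x₀ occur.
    let d = kracht-∧ (kracht-atom zero (var zero) λ _ _ ()) (kracht-sahlqvist em s zero) in
    formula d ,
    record { oneFree = inj₁ (inj₁ refl) ; restrictedlyPositive = restricted d ; atomsUniversal = universal d } ,
    λ F ρ → (⇔-sym (correct d F ρ) ⇔-∘ mk⇔ (refl ,_) proj₂)
            ⇔-∘ (corr F (ρ zero) ⇔-∘ ⊨-cong (expand α) F λ { zero → refl }))
  (λ (β , k , equiv) →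
    let d = sahlqvist-kracht em 0 (restrictedlyPositive k) (atomsUniversal k) in
    implications (clauses d) , implications-sahlqvist (clauses d) ,
    λ F w → (implications-correct (clauses d) F w ⇔-∘ refutes d F (λ _ → w)) ⇔-∘ equiv F (λ _ → w))
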